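{- Let $k\geq 1$, let $n\geq 1$ and $a_1,\ldots,a_k,b$ be integers with $a_i\neq 0$ for at least one $i$, and let $t_1,\ldots,t_k$ be positive divisors of $n$. Consider the linear congruence $a_1x_1+\cdots +a_kx_k\equiv b \pmod{n}$ with $(x_i,n)=t_i$ ($1\leq i\leq k$). For each prime $p\mid n$ let $r_p$, $m_p$, $e_p$ be as defined in the context. If there is a prime $p\mid n$ such that either ($m_p\leq r_p$ and $p^{m_p-1}\nmid b$) or ($m_p\geq r_p+1$ and $p^{r_p}\nmid b$), then this restricted linear congruence has no solution. Otherwise, the number of solutions $\langle x_1,\ldots,x_k\rangle\in\mathbb{Z}_n^k$ is $$\prod_{i=1}^{k} \varphi\left(\frac{n}{t_i}\right)\prod_{\substack{p\,\mid\, n \\ m_p \,\leq \, r_p \\ p^{m_p} \,\mid\, b}} p^{m_p-r_p-1} \left(1-\frac{(-1)^{e_p-1}}{(p-1)^{e_p-1}} \right)\prod_{\substack{p\, \mid\, n \\ m_p \,\leq \, r_p \\ p^{m_p-1} \, \|\, b}} p^{m_p-r_p-1} \left(1-\frac{(-1)^{e_p}}{(p-1)^{e_p}}\right),$$ where the last two products are over the prime factors $p$ of $n$ with the indicated additional properties (the last product is empty and equal to $1$ if $b=0$).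
   Context: $(u,v)$ denotes the greatest common divisor. $\varphi$ is Euler's totient function. A solution is an ordered $k$-tuple of integers modulo $n$, where $\mathbb{Z}_n=\mathbb{Z}/n\mathbb{Z}$ (note that $(x_i,n)$ depends only on $x_i$ modulo $n$). For every prime divisor $p$ of $n$: $r_p$ is the exponent of $p$ in the prime factorization of $n$; $m_p$ is the smallest integer $j\geq 1$ such that $p^j\nmid a_it_i$ for some $i\in\{1,\ldots,k\}$ (it exists because some $a_i\neq 0$); and $e_p=\#\{i: 1\leq i\leq k,\ p^{m_p}\nmid a_it_i\}$. The notation $p^r\,\|\,b$ means $p^r\mid b$ and $p^{r+1}\nmid b$ (so it never holds for $b=0$). Empty products equal $1$. -}

module Defs where

open import Algebra.Definitions.RawMonoid using (sum)
open import Data.Fin using (Fin; toℕ; finToFun)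
open import Data.Fin.Properties using (any?; all?)
open import Data.Integer as ℤ using (ℤ; +_; 0ℤ; 1ℤ; ∣_∣)
import Data.Integer.Divisibility as ℤ
import Data.Integer.Properties as ℤ
open import Data.List using (List; map; filter; length; foldr; upTo; allFin)
open import Data.Nat
open import Data.Nat.Coprimality using (Coprime; coprime?)
open import Data.Nat.Divisibility
open import Data.Nat.GCD using (gcd)
open import Data.Nat.Primality using (Prime; prime?; prime⇒nonTrivial)
open import Data.Nat.Primality.Factorisation using (factors; factorise)
open import Data.Nat.Properties
open import Data.Product using (∃; ∃-syntax; _×_; _,_; proj₁; proj₂)
open import Data.Rational as ℚ using (ℚ; 0ℚ; 1ℚ)
open import Data.Sum using (_⊎_; inj₁; inj₂)
open import Function using (_∘_)
open import Level using (0ℓ)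
open import Relation.Binary.PropositionalEquality
open import Relation.Nullary using (¬_; Dec; yes; no; contradiction; ¬?)
open import Relation.Nullary.Decidable using (_×-dec_)
open import Relation.Unary using (Pred; Decidable)

φ : ℕ → ℕ
φ n = length (filter (λ j → coprime? j n) (map suc (upTo n)))

-- Total division; the value at denominator 0 is junk.
infixl 7 _÷_
_÷_ : ℤ → ℕ → ℚ
i ÷ zero  = 0ℚ
i ÷ suc d = i ℚ./ suc d

fromℕ : ℕ → ℚ
fromℕ n = + n ℚ./ 1

∑ℤ : ∀ {k} → (Fin k → ℤ) → ℤ
∑ℤ = sum ℤ.+-0-rawMonoid

∏ℕ : ∀ {k} → (Fin k → ℕ) → ℕ
∏ℕ = sum *-1-rawMonoid

∏ℚ : List ℕ → (ℕ → ℚ) → ℚ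
∏ℚ ps f = foldr ℚ._*_ 1ℚ (map f ps)

_∣ℤ?_ : ∀ d i → Dec (+ d ℤ.∣ i)
d ∣ℤ? i = d ∣? ∣ i ∣

infix 4 _^_∥_
_^_∥_ : ℕ → ℕ → ℤ → Set
p ^ r ∥ b = + (p ^ r) ℤ.∣ b × ¬ + (p ^ suc r) ℤ.∣ b

∥? : ∀ p r b → Dec (p ^ r ∥ b)
∥? p r b = ((p ^ r) ∣ℤ? b) ×-dec ¬? ((p ^ suc r) ∣ℤ? b)

primeDivisors : ℕ → List ℕ
primeDivisors n = filter (λ p → prime? p ×-dec p ∣? n) (upTo (suc n))

-- The least j < B satisfying P, or B if there is none.
least : ∀ {P : Pred ℕ 0ℓ} → Decidable P → ℕ → ℕ
least P? zero    = zero
least P? (suc B) with P? 0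
... | yes _ = 0
... | no  _ = suc (least (P? ∘ suc) B)

module Congruence {k : ℕ} (n : ℕ) .{{_ : NonZero n}}
                  (a : Fin k → ℤ) (b : ℤ) (t : Fin k → ℕ) where

  -- ℤₙ is represented by Fin n, i.e. by least non-negative residues.
  IsSolution : (Fin k → Fin n) → Set
  IsSolution x = + n ℤ.∣ ∑ℤ (λ i → a i ℤ.* + toℕ (x i)) ℤ.- b
               × (∀ i → gcd (toℕ (x i)) n ≡ t i)

  isSolution? : Decidable IsSolution
  isSolution? x = (n ∣ℤ? (∑ℤ (λ i → a i ℤ.* + toℕ (x i)) ℤ.- b))
            ×-dec all? (λ i → gcd (toℕ (x i)) n ≟ t i)

  -- finToFun is a bijection from Fin (n ^ k) onto the tuples Fin k → Fin n.
  numberOfSolutions : ℕ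
  numberOfSolutions = length (filter isSolution? (map finToFun (allFin (n ^ k))))

  r : ℕ → ℕ
  r p = length (filter (p ≟_) (factors (factorise n)))

  SomeNotDivisible : ℕ → ℕ → Set
  SomeNotDivisible p j = ∃[ i ] ¬ + (p ^ j) ℤ.∣ a i ℤ.* + t i

  someNotDivisible? : ∀ p → Decidable (SomeNotDivisible p)
  someNotDivisible? p j = any? (λ i → ¬? ((p ^ j) ∣ℤ? (a i ℤ.* + t i)))

  -- The search for m p can be cut off at this bound, because p ^ c > c
  -- for c = ∣ aᵢ tᵢ ∣; see m-isLeast.
  bound : ℕ
  bound = sum +-0-rawMonoid (λ i → ∣ a i ℤ.* + t i ∣)

  m : ℕ → ℕ
  m p = suc (least (someNotDivisible? p ∘ suc) bound)

  e : ℕ → ℕ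
  e p = length (filter (λ i → ¬? ((p ^ m p) ∣ℤ? (a i ℤ.* + t i))) (allFin k))

  Obstruction : ℕ → Set
  Obstruction p = (m p ≤ r p × ¬ + (p ^ (m p ∸ 1)) ℤ.∣ b)
                ⊎ (r p + 1 ≤ m p × ¬ + (p ^ r p) ℤ.∣ b)

  primes-∣ primes-∥ : List ℕ
  primes-∣ = filter (λ p → m p ≤? r p ×-dec ((p ^ m p) ∣ℤ? b)) (primeDivisors n)
  primes-∥ = filter (λ p → m p ≤? r p ×-dec ∥? p (m p ∸ 1) b) (primeDivisors n)

  -- p ^ (m - r - 1) * (1 - (-1)ˢ / (p - 1)ˢ), where m ≤ r makes the
  -- exponent of p negative.
  factor : ℕ → ℕ → ℚ
  factor p s = (1ℤ ÷ p ^ (r p + 1 ∸ m p))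
             ℚ.* (1ℚ ℚ.- (ℤ.-1ℤ ℤ.^ s) ÷ (p ∸ 1) ^ s)

private
  least-minimal : ∀ {P : Pred ℕ 0ℓ} (P? : Decidable P) B →
                  ∀ j → j < least P? B → ¬ P j
  least-minimal P? (suc B) j       j<l       Pj with P? 0
  least-minimal P? (suc B) zero    j<l       Pj | no ¬P0 = ¬P0 Pj
  least-minimal P? (suc B) (suc j) (s≤s j<l) Pj | no ¬P0 =
    least-minimal (P? ∘ suc) B j j<l Pj

  least-holds : ∀ {P : Pred ℕ 0ℓ} (P? : Decidable P) B → P B → P (least P? B)
  least-holds P? zero    PB = PB
  least-holds P? (suc B) PB with P? 0
  ... | yes P0 = P0
  ... | no  _  = least-holds (P? ∘ suc) B PB

  n<p^n : ∀ p n → 1 < p → n < p ^ n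
  n<p^n p zero    1<p = s≤s z≤n
  n<p^n p (suc n) 1<p = begin-strict
    suc n           ≤⟨ n<p^n p n 1<p ⟩
    p ^ n           <⟨ m<m+n (p ^ n) (≤-trans (s≤s z≤n) (n<p^n p n 1<p)) ⟩
    p ^ n + p ^ n   ≡⟨ cong (λ z → p ^ n + z) (+-identityʳ (p ^ n)) ⟨
    2 * p ^ n       ≤⟨ *-monoˡ-≤ (p ^ n) 1<p ⟩
    p * p ^ n       ∎
    where open ≤-Reasoning

  ≤-sum : ∀ {k} (f : Fin k → ℕ) i → f i ≤ sum +-0-rawMonoid f
  ≤-sum f Fin.zero    = m≤m+n _ _
  ≤-sum f (Fin.suc i) = ≤-trans (≤-sum (f ∘ Fin.suc) i) (m≤n+m _ _)

module _ {k : ℕ} (n : ℕ) .{{_ : NonZero n}}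
         (a : Fin k → ℤ) (b : ℤ) (t : Fin k → ℕ) where
  open Congruence n a b t

  m-isLeast : (∃[ i ] a i ≢ 0ℤ) → (∀ i → NonZero (t i)) → ∀ p → Prime p →
              1 ≤ m p × SomeNotDivisible p (m p)
              × (∀ j → 1 ≤ j → j < m p → ¬ SomeNotDivisible p j)
  m-isLeast (i , aᵢ≢0) t>0 p prime-p =
    s≤s z≤n , least-holds (someNotDivisible? p ∘ suc) bound (i , p^∤) ,
    λ { (suc j) _ (s≤s j<l) → least-minimal (someNotDivisible? p ∘ suc) bound j j<l }
    where
    1<p : 1 < p
    1<p = nonTrivial⇒n>1 p {{prime⇒nonTrivial prime-p}}

    aᵢtᵢ≢0 : NonZero ∣ a i ℤ.* + t i ∣
    aᵢtᵢ≢0 = subst NonZero (sym (ℤ.abs-* (a i) (+ t i)))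
      (m*n≢0 _ _ {{≢-nonZero (aᵢ≢0 ∘ ℤ.∣i∣≡0⇒i≡0)}} {{t>0 i}})

    p^∤ : ¬ p ^ suc bound ∣ ∣ a i ℤ.* + t i ∣
    p^∤ = >⇒∤ {{aᵢtᵢ≢0}} (≤-<-trans
      (≤-trans (≤-sum (λ i → ∣ a i ℤ.* + t i ∣) i) (n≤1+n bound))
      (n<p^n p (suc bound) 1<p))

{-# OPTIONS --safe #-}
module Submission where

-- Let N (n , c) be the number of x ∈ ℤₙᵏ with (xᵢ , n) = (tᵢ , n) and n ∣ c + ∑ᵢ aᵢ xᵢ.
-- By the Chinese remainder theorem N is multiplicative in n, and so is the number of
-- admissible xᵢ, which is φ (n / tᵢ) when tᵢ ∣ n; so only n = pʳ matters.  If pʳ divides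
-- every aᵢ tᵢ, all admissible x give the same residue.  Otherwise M = m - 1 < r, and moving
-- a coordinate with p ^ m ∤ aᵢ tᵢ by multiples of tᵢ p shows that N (pʳ , c) depends only on
-- c modulo p ^ m.  Hence N (pʳ , c) is p ^ (m - r) times the number of admissible x solving
-- the congruence modulo p ^ m.  There, each of the e terms aᵢ xᵢ with p ^ m ∤ aᵢ tᵢ is
-- evenly spread over the p - 1 residues y with p ^ M ∥ y, while the other terms vanish, and
-- the count follows by induction on the number of coordinates.

-- No roots of unity enter. Counts are sums of integer-valued indicators, and the summands are
-- periodic functions on all of ℤ, so that a change of variable is an exchange of two finite sums
-- and not a permutation of `Fin n`. The even spread of a single term aᵢ xᵢ comes from a double
-- count over the multiples u c, 0 ≤ u < p, of the target c. The local count is kept in ℤ,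
-- multiplied by p ^ (r - M) * (p - 1) ^ e, and one formula serves both products of the theorem: b
-- enters it only through the indicator of p ^ m ∣ b. If the indicator is 1, the formula has a spare
-- factor p - 1, which is why the first product has exponent e - 1; if it is 0, nothing cancels and
-- the exponent stays e. Fractions appear only after these local identities are established.

-- Sums of periodic functions over residue classes

module ResidueSums where
  open import Data.Bool using (if_then_else_)
  open import Data.Fin using (Fin; zero; suc; toℕ; fromℕ<; punchIn)
  open import Data.Fin.Properties using (toℕ<n; toℕ-injective; toℕ-fromℕ<; punchInᵢ≢i)
  open import Data.Integer using (ℤ; +_; -[1+_]; 0ℤ; 1ℤ; ∣_∣; _+_; _*_; _-_; -_)
  open import Data.Integer.DivMod using (_%ℕ_; _/ℕ_; a≡a%ℕn+[a/ℕn]*n; n%ℕd<d)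
  open import Data.Integer.Divisibility.Signed
  open import Data.Integer.Properties
  open import Data.Integer.Tactic.RingSolver using (solve-∀)
  open import Data.Nat as ℕ using (ℕ; NonZero)
  open import Data.Nat.Coprimality as Coprimality using (Coprime; coprime-Bézout; coprime-divisor)
  import Data.Nat.Divisibility as ℕ
  open import Data.Nat.GCD using (module Bézout)
  import Data.Nat.Properties as ℕ
  open import Data.Product using (∃-syntax; _×_; _,_; proj₁; proj₂)
  open import Function using (_∘_)
  open import Level using (Level)
  open import Relation.Binary.PropositionalEquality
  open import Relation.Nullary using (¬_; Dec; yes; no; does; contradiction)

  open import Algebra.Properties.Semiring.Sum +-*-semiring public
    using (sum; ∑-comm; ∑-distrib-+; sum-cong-≗; sum-replicate-zero; sum-remove;
           *-distribˡ-sum; *-distribʳ-sum)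

  private variable
    ℓ ℓ′ ℓ″ : Level
    P : Set ℓ
    Q : Set ℓ′
    R : Set ℓ″

  opaque
    -- The Iverson bracket. It is opaque, so that decision procedures stay folded in goals and only
    -- the rules of this block are ever used.
    ⟦_⟧ : Dec P → ℤ
    ⟦ P? ⟧ = if does P? then 1ℤ else 0ℤ

    ⟦⟧-true : (P? : Dec P) → P → ⟦ P? ⟧ ≡ 1ℤ
    ⟦⟧-true (yes _)  _ = refl
    ⟦⟧-true (no ¬p) p = contradiction p ¬p

    ⟦⟧-false : (P? : Dec P) → ¬ P → ⟦ P? ⟧ ≡ 0ℤ
    ⟦⟧-false (yes p) ¬p = contradiction p ¬p
    ⟦⟧-false (no _)  _  = refl

    ⟦⟧-cong : (P? : Dec P) (Q? : Dec Q) → (P → Q) → (Q → P) → ⟦ P? ⟧ ≡ ⟦ Q? ⟧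
    ⟦⟧-cong P? (yes q) _   Q⇒P = ⟦⟧-true P? (Q⇒P q)
    ⟦⟧-cong P? (no ¬q) P⇒Q _   = ⟦⟧-false P? (¬q ∘ P⇒Q)

    ⟦⟧-× : (P? : Dec P) (Q? : Dec Q) (R? : Dec R) →
           (P → Q × R) → (Q × R → P) → ⟦ P? ⟧ ≡ ⟦ Q? ⟧ * ⟦ R? ⟧
    ⟦⟧-× P? (yes q) (yes r) _    QR⇒P = ⟦⟧-true P? (QR⇒P (q , r))
    ⟦⟧-× P? (yes _) (no ¬r) P⇒QR _    = ⟦⟧-false P? (¬r ∘ proj₂ ∘ P⇒QR)
    ⟦⟧-× P? (no ¬q) R?      P⇒QR _    =
      trans (⟦⟧-false P? (¬q ∘ proj₁ ∘ P⇒QR)) (sym (*-zeroˡ ⟦ R? ⟧))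

    -- Summands may be rewritten under the assumption that their weight is not zero; `w-guard` is
    -- the instance used for admissible x.
    ⟦⟧*-cong : (P? : Dec P) {x y : ℤ} → (P → x ≡ y) → ⟦ P? ⟧ * x ≡ ⟦ P? ⟧ * y
    ⟦⟧*-cong (yes p) x≡y = cong (1ℤ *_) (x≡y p)
    ⟦⟧*-cong (no _)  _   = refl

  ∣-resp : ∀ {k i j} → i ≡ j → k ∣ i → k ∣ j
  ∣-resp refl k∣i = k∣i

  *∣⇒∣ : ∀ q m {x} → + (q ℕ.* m) ∣ x → + q ∣ x
  *∣⇒∣ q m = ∣-trans (divides (+ m) (trans (pos-* q m) (*-comm (+ q) (+ m))))

  *∣⇒∣ʳ : ∀ q m {x} → + (q ℕ.* m) ∣ x → + m ∣ x
  *∣⇒∣ʳ q m = ∣-trans (divides (+ q) (pos-* q m))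

  coprime⇒*∣ : ∀ {q m x} → Coprime q m → + q ∣ x → + m ∣ x → + (q ℕ.* m) ∣ x
  coprime⇒*∣ {q} {m} {x} q⊥m q∣x m∣x with ∣⇒∣ᵤ q∣x
  ... | ℕ.divides k x≡kq = ∣ᵤ⇒∣ (subst (q ℕ.* m ℕ.∣_) (sym x≡qk) (ℕ.*-monoʳ-∣ q m∣k))
    where
    x≡qk : ∣ x ∣ ≡ q ℕ.* k
    x≡qk = trans x≡kq (ℕ.*-comm k q)
    m∣k : m ℕ.∣ k
    m∣k = coprime-divisor (Coprimality.sym q⊥m) (subst (m ℕ.∣_) x≡qk (∣⇒∣ᵤ m∣x))

  inverse : ∀ c n → Coprime ∣ c ∣ n → ∃[ c′ ] + n ∣ c * c′ - 1ℤ
  inverse c n c⊥n = helper c (natural (coprime-Bézout c⊥n))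
    where
    lift : ∀ x y m → 1 ℕ.+ y ℕ.* n ≡ x ℕ.* m → 1ℤ + + y * + n ≡ + x * + m
    lift x y m eq = trans (cong (λ z → 1ℤ + z) (sym (pos-* y n))) (trans (cong +_ eq) (pos-* x m))
    natural : ∀ {m} → Bézout.Identity 1 m n → ∃[ c′ ] + n ∣ + m * c′ - 1ℤ
    natural {m} (Bézout.+- x y eq) = + x , divides (+ y)
      (trans (cong (_- 1ℤ) (trans (*-comm (+ m) (+ x)) (sym (lift x y m eq)))) (shuffle (+ y * + n)))
      where
      shuffle : ∀ z → 1ℤ + z - 1ℤ ≡ z
      shuffle = solve-∀
    natural {m} (Bézout.-+ x y eq) = - + x , divides (- + y)
      (trans (cong (λ z → + m * - + x - z) (trans one (cong (_- + x * + m) (pos-* y n)))) (shuffle (+ m) (+ x) (+ y) (+ n)))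
      where
      one : 1ℤ ≡ + (y ℕ.* n) - + x * + m
      one = trans (shuffle′ (+ x * + m)) (cong (_- + x * + m)
        (trans (cong (λ z → 1ℤ + z) (sym (pos-* x m))) (cong +_ eq)))
        where
        shuffle′ : ∀ z → 1ℤ ≡ (1ℤ + z) - z
        shuffle′ = solve-∀
      shuffle : ∀ m x y n → m * - x - (y * n - x * m) ≡ - y * n
      shuffle = solve-∀
    helper : ∀ c → ∃[ c′ ] + n ∣ + ∣ c ∣ * c′ - 1ℤ → ∃[ c′ ] + n ∣ c * c′ - 1ℤ
    helper (+ _)      inv        = inv
    helper -[1+ m ] (c′ , n∣) = - c′ , ∣-resp (shuffle (+ ℕ.suc m) c′) n∣
      where
      shuffle : ∀ x y → x * y - 1ℤ ≡ - x * - y - 1ℤ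
      shuffle = solve-∀

  -- Such a `g` stands for a function on ℤ/n. It can be evaluated at any integer, so arguments never
  -- have to be reduced modulo `n`.
  Periodic : ℕ → (ℤ → ℤ) → Set
  Periodic n g = ∀ x y → + n ∣ x - y → g x ≡ g y

  opaque
    -- For a periodic summand this is the sum over ℤ/n. It is opaque, so that goals show `Σ<` and
    -- not a sum over `Fin n`.
    Σ< : ℕ → (ℤ → ℤ) → ℤ
    Σ< n g = sum {n} (λ j → g (+ toℕ j))

    Σ<-cong : ∀ n {f g} → (∀ x → f x ≡ g x) → Σ< n f ≡ Σ< n g
    Σ<-cong n f≗g = sum-cong-≗ {n} (λ j → f≗g (+ toℕ j))

    Σ<-comm : ∀ m n (f : ℤ → ℤ → ℤ) → Σ< m (λ x → Σ< n (f x)) ≡ Σ< n (λ y → Σ< m (λ x → f x y))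
    Σ<-comm m n f = ∑-comm {m} {n} (λ i j → f (+ toℕ i) (+ toℕ j))

    Σ<-*ˡ : ∀ n x g → x * Σ< n g ≡ Σ< n (λ j → x * g j)
    Σ<-*ˡ n x g = *-distribˡ-sum {n} x (λ j → g (+ toℕ j))

    Σ<-*ʳ : ∀ n x g → Σ< n g * x ≡ Σ< n (λ j → g j * x)
    Σ<-*ʳ n x g = *-distribʳ-sum {n} x (λ j → g (+ toℕ j))

    Σ<-+ : ∀ n f g → Σ< n (λ x → f x + g x) ≡ Σ< n f + Σ< n g
    Σ<-+ n f g = ∑-distrib-+ {n} (λ j → f (+ toℕ j)) (λ j → g (+ toℕ j))

    Σ<-const : ∀ n x → Σ< n (λ _ → x) ≡ + n * x
    Σ<-const ℕ.zero    x = sym (*-zeroˡ x)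
    Σ<-const (ℕ.suc n) x = trans (cong (λ y → x + y) (Σ<-const n x)) (sym (suc-* (+ n) x))

    Σ<-0 : ∀ n {g} → (∀ x → g x ≡ 0ℤ) → Σ< n g ≡ 0ℤ
    Σ<-0 n g≗0 = trans (Σ<-cong n g≗0) (sum-replicate-zero n)

  sum-single : ∀ {n} (f : Fin n → ℤ) i → (∀ j → j ≢ i → f j ≡ 0ℤ) → sum f ≡ f i
  sum-single {ℕ.suc n} f i f≡0 = begin
    sum f                          ≡⟨ sum-remove {i = i} f ⟩
    f i + sum (f ∘ punchIn i)      ≡⟨ cong (λ z → f i + z) (sum-cong-≗ (λ j → f≡0 _ (punchInᵢ≢i i j))) ⟩
    f i + sum {n} (λ _ → 0ℤ)       ≡⟨ cong (λ z → f i + z) (sum-replicate-zero n) ⟩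
    f i + 0ℤ                       ≡⟨ +-identityʳ (f i) ⟩
    f i                            ∎
    where open ≡-Reasoning

  opaque
    unfolding Σ<

    -- Σ-pick and the counts below all reduce to this: a residue class modulo n
    -- has exactly one representative in [0, n).
    Σ-unit : ∀ n .{{_ : NonZero n}} z → Σ< n (λ j → ⟦ + n ∣? z - j ⟧) ≡ 1ℤ
    Σ-unit n z = trans (sum-single _ i (λ j j≢i → ⟦⟧-false (+ n ∣? z - + toℕ j) (j≢i ∘ unique j)))
                       (⟦⟧-true (+ n ∣? z - + toℕ i) n∣z-i)
      where
      z%n<n : z %ℕ n ℕ.< n
      z%n<n = n%ℕd<d z n
      i : Fin n
      i = fromℕ< z%n<n
      n∣z-i : + n ∣ z - + toℕ i
      n∣z-i = divides (z /ℕ n) (trans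
        (cong₂ _-_ (a≡a%ℕn+[a/ℕn]*n z n) (cong +_ (toℕ-fromℕ< z%n<n)))
        (shuffle (+ (z %ℕ n)) (z /ℕ n * + n)))
        where
        shuffle : ∀ x y → x + y - x ≡ y
        shuffle = solve-∀
      unique : ∀ j → + n ∣ z - + toℕ j → j ≡ i
      unique j n∣z-j = toℕ-injective (+-injective (i-j≡0⇒i≡j (+ toℕ j) (+ toℕ i) (∣i∣≡0⇒i≡0 small)))
        where
        shuffle : ∀ z x y → (z - y) - (z - x) ≡ x - y
        shuffle = solve-∀
        n∣j-i : + n ∣ + toℕ j - + toℕ i
        n∣j-i = ∣-resp (shuffle z (+ toℕ j) (+ toℕ i)) (∣m∣n⇒∣m-n n∣z-i n∣z-j)
        bound : ∣ + toℕ j - + toℕ i ∣ ℕ.< n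
        bound = ℕ.≤-<-trans
          (subst (λ z → ∣ z ∣ ℕ.≤ toℕ j ℕ.⊔ toℕ i) (sym (m-n≡m⊖n (toℕ j) (toℕ i))) (∣m⊝n∣≤m⊔n (toℕ j) (toℕ i)))
          (ℕ.⊔-pres-<m (toℕ<n j) (toℕ<n i))
        small : ∣ + toℕ j - + toℕ i ∣ ≡ 0
        small = ∣∧<⇒≡0 (∣⇒∣ᵤ n∣j-i) bound
          where
          ∣∧<⇒≡0 : ∀ {m n} → n ℕ.∣ m → m ℕ.< n → m ≡ 0
          ∣∧<⇒≡0 {ℕ.zero}  _   _   = refl
          ∣∧<⇒≡0 {ℕ.suc m} n∣m m<n = contradiction n∣m (ℕ.>⇒∤ m<n)

  -- The bracket forces j ≡ z, where periodicity gives g j = g z. Read from right to left, this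
  -- expands `g z` over the residue classes, which is the way variables are changed below.
  Σ-pick : ∀ n .{{_ : NonZero n}} {g} → Periodic n g → ∀ z →
           Σ< n (λ j → ⟦ + n ∣? z - j ⟧ * g j) ≡ g z
  Σ-pick n {g} g-per z = begin
    Σ< n (λ j → ⟦ + n ∣? z - j ⟧ * g j) ≡⟨ Σ<-cong n (λ j → ⟦⟧*-cong (+ n ∣? z - j) (λ n∣ → sym (g-per z j n∣))) ⟩
    Σ< n (λ j → ⟦ + n ∣? z - j ⟧ * g z) ≡⟨ Σ<-*ʳ n (g z) (λ j → ⟦ + n ∣? z - j ⟧) ⟨
    Σ< n (λ j → ⟦ + n ∣? z - j ⟧) * g z ≡⟨ cong (_* g z) (Σ-unit n z) ⟩
    1ℤ * g z                            ≡⟨ *-identityˡ (g z) ⟩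
    g z                                 ∎
    where open ≡-Reasoning

  -- Each term is expanded by `Σ-pick`. After the two sums are exchanged, c j + i ≡ y has for fixed
  -- y the single solution j ≡ c′ (y - i) modulo n.
  Σ-affine : ∀ n .{{_ : NonZero n}} {g} → Periodic n g → ∀ c i → Coprime ∣ c ∣ n →
             Σ< n (λ j → g (c * j + i)) ≡ Σ< n g
  Σ-affine n {g} g-per c i c⊥n with inverse c n c⊥n
  ... | c′ , n∣cc′-1 = begin
    Σ< n (λ j → g (c * j + i))
      ≡⟨ Σ<-cong n (λ j → Σ-pick n g-per (c * j + i)) ⟨
    Σ< n (λ j → Σ< n (λ y → ⟦ + n ∣? c * j + i - y ⟧ * g y))
      ≡⟨ Σ<-comm n n (λ j y → ⟦ + n ∣? c * j + i - y ⟧ * g y) ⟩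
    Σ< n (λ y → Σ< n (λ j → ⟦ + n ∣? c * j + i - y ⟧ * g y))
      ≡⟨ Σ<-cong n (λ y → Σ<-*ʳ n (g y) (λ j → ⟦ + n ∣? c * j + i - y ⟧)) ⟨
    Σ< n (λ y → Σ< n (λ j → ⟦ + n ∣? c * j + i - y ⟧) * g y)
      ≡⟨ Σ<-cong n (λ y → cong (_* g y) (trans (Σ<-cong n (solve-for-j y)) (Σ-unit n (c′ * (y - i))))) ⟩
    Σ< n (λ y → 1ℤ * g y)
      ≡⟨ Σ<-cong n (λ y → *-identityˡ (g y)) ⟩
    Σ< n g ∎
    where
    open ≡-Reasoning
    -- The congruence is multiplied by - c′ in `forth` and by - c in `back`; the terms with c c′ - 1
    -- vanish modulo n and make these exact identities.
    forth : ∀ c c′ i j y → - c′ * (c * j + i - y) + (c * c′ - 1ℤ) * j ≡ c′ * (y - i) - j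
    forth = solve-∀
    back : ∀ c c′ i j y → - c * (c′ * (y - i) - j) + (c * c′ - 1ℤ) * (y - i) ≡ c * j + i - y
    back = solve-∀
    solve-for-j : ∀ y j → ⟦ + n ∣? c * j + i - y ⟧ ≡ ⟦ + n ∣? c′ * (y - i) - j ⟧
    solve-for-j y j = ⟦⟧-cong (+ n ∣? c * j + i - y) (+ n ∣? c′ * (y - i) - j)
      (λ d → ∣-resp (forth c c′ i j y) (∣m∣n⇒∣m+n (∣n⇒∣m*n (- c′) d) (∣m⇒∣m*n j n∣cc′-1)))
      (λ d → ∣-resp (back c c′ i j y) (∣m∣n⇒∣m+n (∣n⇒∣m*n (- c) d) (∣m⇒∣m*n (y - i) n∣cc′-1)))

  chineseRemainder : ∀ q m → Coprime q m → ∀ i j → ∃[ z ] ((+ q ∣ z - i) × (+ m ∣ z - j))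
  chineseRemainder q m q⊥m i j with inverse (+ q) m q⊥m
  -- A multiple of q is added to i, and q q′ ≡ 1 modulo m turns that multiple into j - i there.
  ... | q′ , m∣qq′-1 = i + q′ * (j - i) * + q
                    , divides (q′ * (j - i)) (left (+ q) q′ i j)
                    , ∣-resp (right (+ q) q′ i j) (∣m⇒∣m*n (j - i) m∣qq′-1)
    where
    left : ∀ q q′ i j → i + q′ * (j - i) * q - i ≡ q′ * (j - i) * q
    left = solve-∀
    right : ∀ q q′ i j → (q * q′ - 1ℤ) * (j - i) ≡ i + q′ * (j - i) * q - j
    right = solve-∀

  -- Both factors are expanded by `Σ-pick` over classes i modulo q and j modulo m. For each pair the
  -- two brackets combine to a single one modulo q m, centred at a Chinese remainder z, and `Σ-unit`
  -- sums it to 1.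
  Σ-crt : ∀ q m .{{_ : NonZero q}} .{{_ : NonZero m}} → Coprime q m → ∀ {f g} →
          Periodic q f → Periodic m g →
          Σ< (q ℕ.* m) (λ x → f x * g x) ≡ Σ< q f * Σ< m g
  Σ-crt q m q⊥m {f} {g} f-per g-per = begin
    Σ< (q ℕ.* m) (λ x → f x * g x)
      ≡⟨ Σ<-cong (q ℕ.* m) expand ⟩
    Σ< (q ℕ.* m) (λ x → Σ< q (λ i → Σ< m (K x i)))
      ≡⟨ Σ<-comm (q ℕ.* m) q (λ x i → Σ< m (K x i)) ⟩
    Σ< q (λ i → Σ< (q ℕ.* m) (λ x → Σ< m (K x i)))
      ≡⟨ Σ<-cong q (λ i → Σ<-comm (q ℕ.* m) m (λ x → K x i)) ⟩
    Σ< q (λ i → Σ< m (λ j → Σ< (q ℕ.* m) (λ x → K x i j)))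
      ≡⟨ Σ<-cong q (λ i → Σ<-cong m (λ j → collapse i j)) ⟩
    Σ< q (λ i → Σ< m (λ j → f i * g j))
      ≡⟨ Σ<-cong q (λ i → Σ<-*ˡ m (f i) g) ⟨
    Σ< q (λ i → f i * Σ< m g)
      ≡⟨ Σ<-*ʳ q (Σ< m g) f ⟨
    Σ< q f * Σ< m g ∎
    where
    open ≡-Reasoning
    instance _ = ℕ.m*n≢0 q m
    δ : ℤ → ℤ → ℤ → ℤ
    δ x i j = ⟦ + q ∣? x - i ⟧ * ⟦ + m ∣? x - j ⟧
    K : ℤ → ℤ → ℤ → ℤ
    K x i j = δ x i j * (f i * g j)
    shuffle : ∀ a b c d → (a * b) * (c * d) ≡ (a * c) * (b * d)
    shuffle = solve-∀
    expand : ∀ x → f x * g x ≡ Σ< q (λ i → Σ< m (K x i))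
    expand x = begin
      f x * g x
        ≡⟨ cong₂ _*_ (Σ-pick q f-per x) (Σ-pick m g-per x) ⟨
      Σ< q (λ i → ⟦ + q ∣? x - i ⟧ * f i) * Σ< m (λ j → ⟦ + m ∣? x - j ⟧ * g j)
        ≡⟨ Σ<-*ʳ q G F ⟩
      Σ< q (λ i → (⟦ + q ∣? x - i ⟧ * f i) * Σ< m (λ j → ⟦ + m ∣? x - j ⟧ * g j))
        ≡⟨ Σ<-cong q (λ i → Σ<-*ˡ m (F i) (λ j → ⟦ + m ∣? x - j ⟧ * g j)) ⟩
      Σ< q (λ i → Σ< m (λ j → (⟦ + q ∣? x - i ⟧ * f i) * (⟦ + m ∣? x - j ⟧ * g j)))
        ≡⟨ Σ<-cong q (λ i → Σ<-cong m (λ j → shuffle ⟦ + q ∣? x - i ⟧ (f i) ⟦ + m ∣? x - j ⟧ (g j))) ⟩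
      Σ< q (λ i → Σ< m (K x i)) ∎
      where
      F : ℤ → ℤ
      F i = ⟦ + q ∣? x - i ⟧ * f i
      G : ℤ
      G = Σ< m (λ j → ⟦ + m ∣? x - j ⟧ * g j)
    untelescope : ∀ x y z → (x - z) - (y - z) ≡ x - y
    untelescope = solve-∀
    collapseAt : ∀ i j z → + q ∣ z - i → + m ∣ z - j → Σ< (q ℕ.* m) (λ x → K x i j) ≡ f i * g j
    collapseAt i j z q∣z-i m∣z-j = begin
      Σ< (q ℕ.* m) (λ x → K x i j)
        ≡⟨ Σ<-*ʳ (q ℕ.* m) (f i * g j) (λ x → δ x i j) ⟨
      Σ< (q ℕ.* m) (λ x → ⟦ + q ∣? x - i ⟧ * ⟦ + m ∣? x - j ⟧) * (f i * g j)
        ≡⟨ cong (_* (f i * g j)) (Σ<-cong (q ℕ.* m) both) ⟩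
      Σ< (q ℕ.* m) (λ x → ⟦ + (q ℕ.* m) ∣? z - x ⟧) * (f i * g j)
        ≡⟨ cong (_* (f i * g j)) (Σ-unit (q ℕ.* m) z) ⟩
      1ℤ * (f i * g j)
        ≡⟨ *-identityˡ (f i * g j) ⟩
      f i * g j ∎
      where
      both : ∀ x → ⟦ + q ∣? x - i ⟧ * ⟦ + m ∣? x - j ⟧ ≡ ⟦ + (q ℕ.* m) ∣? z - x ⟧
      both x = sym (⟦⟧-× (+ (q ℕ.* m) ∣? z - x) (+ q ∣? x - i) (+ m ∣? x - j)
        (λ d → ∣-resp (untelescope′ x z i) (∣m∣n⇒∣m-n q∣z-i (*∣⇒∣ q m d))
             , ∣-resp (untelescope′ x z j) (∣m∣n⇒∣m-n m∣z-j (*∣⇒∣ʳ q m d)))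
        (λ (q∣ , m∣) → coprime⇒*∣ q⊥m (∣-resp (untelescope z x i) (∣m∣n⇒∣m-n q∣z-i q∣))
                                      (∣-resp (untelescope z x j) (∣m∣n⇒∣m-n m∣z-j m∣))))
        where
        untelescope′ : ∀ x z i → (z - i) - (z - x) ≡ x - i
        untelescope′ = solve-∀
    collapse : ∀ i j → Σ< (q ℕ.* m) (λ x → K x i j) ≡ f i * g j
    collapse i j = let z , q∣z-i , m∣z-j = chineseRemainder q m q⊥m i j in collapseAt i j z q∣z-i m∣z-j

-- Admissible values of one coordinate: the condition on the gcd with n

module Weights where
  open ResidueSums
  open import Data.Integer using (ℤ; +_; ∣_∣; _+_; _*_; _-_; -_)
  open import Data.Integer.Divisibility.Signed
  open import Data.Integer.Properties
  open import Data.Integer.Tactic.RingSolver using (solve-∀)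
  open import Data.Nat as ℕ using (ℕ)
  open import Data.Nat.Coprimality as Coprimality using (Coprime; coprime-divisor)
  import Data.Nat.Divisibility as ℕ
  open import Data.Nat.GCD
  open import Data.Nat.Primality using (Prime; prime⇒nonZero; prime⇒irreducible)
  import Data.Nat.Properties as ℕ
  open import Data.Product using (∃-syntax; _×_; _,_)
  open import Data.Sum using (inj₁; inj₂)
  open import Relation.Binary.PropositionalEquality
  open import Relation.Nullary using (¬_; yes; no; contradiction)

  prime∧∤⇒coprime : ∀ {p m} → Prime p → ¬ p ℕ.∣ m → Coprime p m
  prime∧∤⇒coprime p-prime p∤m (d∣p , d∣m) with prime⇒irreducible p-prime d∣p
  ... | inj₁ d≡1  = d≡1
  ... | inj₂ refl = contradiction d∣m p∤m

  coprime-*ʳ : ∀ {m n o} → Coprime m n → Coprime m o → Coprime m (n ℕ.* o)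
  coprime-*ʳ m⊥n m⊥o (d∣m , d∣no) =
    m⊥o (d∣m , coprime-divisor (λ (e∣d , e∣n) → m⊥n (ℕ.∣-trans e∣d d∣m , e∣n)) d∣no)

  coprime-^ʳ : ∀ {m n} r → Coprime m n → Coprime m (n ℕ.^ r)
  coprime-^ʳ ℕ.zero    m⊥n = Coprimality.sym (Coprimality.1-coprimeTo _)
  coprime-^ʳ (ℕ.suc r) m⊥n = coprime-*ʳ m⊥n (coprime-^ʳ r m⊥n)

  ^-monoʳ-∣ : ∀ p {i j} → i ℕ.≤ j → p ℕ.^ i ℕ.∣ p ℕ.^ j
  ^-monoʳ-∣ p {i} {j} i≤j = ℕ.divides (p ℕ.^ (j ℕ.∸ i))
    (trans (cong (p ℕ.^_) (sym (ℕ.m∸n+n≡m i≤j))) (ℕ.^-distribˡ-+-* p (j ℕ.∸ i) i))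

  ∣p^r⇒≡p^j : ∀ {p} → Prime p → ∀ r {d} → d ℕ.∣ p ℕ.^ r → ∃[ j ] (j ℕ.≤ r × d ≡ p ℕ.^ j)
  ∣p^r⇒≡p^j         p-prime ℕ.zero    d∣1   = 0 , ℕ.z≤n , ℕ.∣1⇒≡1 d∣1
  ∣p^r⇒≡p^j {p} p-prime (ℕ.suc r) {d} d∣p^ with p ℕ.∣? d
  ... | no p∤d =
    let j , j≤r , d≡p^j = ∣p^r⇒≡p^j p-prime r
                            (coprime-divisor (Coprimality.sym (prime∧∤⇒coprime p-prime p∤d)) d∣p^)
    in j , ℕ.m≤n⇒m≤1+n j≤r , d≡p^j
  ... | yes (ℕ.divides d′ refl) =
    let instance _ = prime⇒nonZero p-prime
        j , j≤r , d′≡p^j = ∣p^r⇒≡p^j p-prime r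
                             (ℕ.*-cancelˡ-∣ p (subst (ℕ._∣ p ℕ.* p ℕ.^ r) (ℕ.*-comm d′ p) d∣p^))
    in ℕ.suc j , ℕ.s≤s j≤r , trans (ℕ.*-comm d′ p) (cong (p ℕ.*_) d′≡p^j)

  gcd-∣gcd : ∀ n x y → (∀ d → d ℕ.∣ n → d ℕ.∣ x → d ℕ.∣ y) → gcd x n ℕ.∣ gcd y n
  gcd-∣gcd n x y x⇒y = gcd-greatest (x⇒y _ (gcd[m,n]∣n x n) (gcd[m,n]∣m x n)) (gcd[m,n]∣n x n)

  -- Reduces the invariances of `w` to statements about which divisors of n divide x.
  gcd-ext : ∀ n x y → (∀ d → d ℕ.∣ n → d ℕ.∣ x → d ℕ.∣ y) → (∀ d → d ℕ.∣ n → d ℕ.∣ y → d ℕ.∣ x) →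
            gcd x n ≡ gcd y n
  gcd-ext n x y x⇒y y⇒x = ℕ.∣-antisym (gcd-∣gcd n x y x⇒y) (gcd-∣gcd n y x y⇒x)

  gcd-∣ : ∀ {n x y d} → gcd x n ≡ gcd y n → d ℕ.∣ n → d ℕ.∣ x → d ℕ.∣ y
  gcd-∣ {n} {x} {y} {d} eq d∣n d∣x = ℕ.∣-trans (subst (d ℕ.∣_) eq (gcd-greatest d∣x d∣n)) (gcd[m,n]∣m y n)

  -- The link between aᵢ tᵢ, on which m and e depend, and aᵢ xᵢ, which enters the congruence: since
  -- gcd (a x , a n) = a gcd (x , n), no divisor of n distinguishes the two when xᵢ is admissible.
  gcd-∣-* : ∀ {n x y d} a → gcd x n ≡ gcd y n → d ℕ.∣ n → d ℕ.∣ a ℕ.* x → d ℕ.∣ a ℕ.* y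
  gcd-∣-* {n} {x} {y} {d} a eq d∣n d∣ax = begin
    d                         ∣⟨ gcd-greatest d∣ax (ℕ.∣n⇒∣m*n a d∣n) ⟩
    gcd (a ℕ.* x) (a ℕ.* n)   ≡⟨ c*gcd[m,n]≡gcd[cm,cn] a x n ⟨
    a ℕ.* gcd x n             ≡⟨ cong (a ℕ.*_) eq ⟩
    a ℕ.* gcd y n             ∣⟨ ℕ.*-monoʳ-∣ a (gcd[m,n]∣m y n) ⟩
    a ℕ.* y                   ∎
    where open ℕ.∣-Reasoning

  gcdℤ : ℤ → ℕ → ℕ
  gcdℤ x n = gcd ∣ x ∣ n

  gcd-∣-*ℤ : ∀ {n d} a x y → gcdℤ x n ≡ gcdℤ y n → d ℕ.∣ n → + d ∣ a * x → + d ∣ a * y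
  gcd-∣-*ℤ {n} {d} a x y eq d∣n d∣ax = ∣ᵤ⇒∣ (subst (d ℕ.∣_) (sym (abs-* a y))
    (gcd-∣-* {n} {∣ x ∣} {∣ y ∣} ∣ a ∣ eq d∣n (subst (d ℕ.∣_) (abs-* a x) (∣⇒∣ᵤ d∣ax))))

  -- The argument d ∣ q d, d ∣ q m, hence d ∣ q gcd (d , m), is applied twice. It splits a divisor
  -- of q m into parts that `w-crt` can test modulo q and modulo m.
  ∣q*m⇒∣gcd*gcd : ∀ {q m d} → d ℕ.∣ q ℕ.* m → d ℕ.∣ gcd d q ℕ.* gcd d m
  ∣q*m⇒∣gcd*gcd {q} {m} {d} d∣qm = begin
    d                                             ∣⟨ gcd-greatest (ℕ.∣n⇒∣m*n (gcd d m) ℕ.∣-refl) d∣gq ⟩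
    gcd (gcd d m ℕ.* d) (gcd d m ℕ.* q)           ≡⟨ c*gcd[m,n]≡gcd[cm,cn] (gcd d m) d q ⟨
    gcd d m ℕ.* gcd d q                           ≡⟨ ℕ.*-comm (gcd d m) (gcd d q) ⟩
    gcd d q ℕ.* gcd d m                           ∎
    where
    open ℕ.∣-Reasoning
    d∣gq : d ℕ.∣ gcd d m ℕ.* q
    d∣gq = begin
      d                            ∣⟨ gcd-greatest (ℕ.∣n⇒∣m*n q ℕ.∣-refl) d∣qm ⟩
      gcd (q ℕ.* d) (q ℕ.* m)      ≡⟨ c*gcd[m,n]≡gcd[cm,cn] q d m ⟨
      q ℕ.* gcd d m                ≡⟨ ℕ.*-comm q (gcd d m) ⟩
      gcd d m ℕ.* q                ∎

  w : ℕ → ℕ → ℤ → ℤ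
  w n t x = ⟦ gcdℤ x n ℕ.≟ gcd t n ⟧

  w-cong : ∀ n t x y → gcdℤ x n ≡ gcdℤ y n → w n t x ≡ w n t y
  w-cong n t x y eq = ⟦⟧-cong (gcdℤ x n ℕ.≟ gcd t n) (gcdℤ y n ℕ.≟ gcd t n) (trans (sym eq)) (trans eq)

  w-periodic : ∀ n t → Periodic n (w n t)
  w-periodic n t x y n∣x-y = w-cong n t x y (gcd-ext n ∣ x ∣ ∣ y ∣
    (λ d d∣n d∣x → ∣⇒∣ᵤ (∣-resp (shuffle x y) (∣m∣n⇒∣m-n (∣ᵤ⇒∣ {+ d} {x} d∣x) (d∣x-y d∣n))))
    (λ d d∣n d∣y → ∣⇒∣ᵤ (∣-resp (shuffle′ x y) (∣m∣n⇒∣m+n (∣ᵤ⇒∣ {+ d} {y} d∣y) (d∣x-y d∣n)))))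
    where
    shuffle : ∀ x y → x - (x - y) ≡ y
    shuffle = solve-∀
    shuffle′ : ∀ x y → y + (x - y) ≡ x
    shuffle′ = solve-∀
    d∣x-y : ∀ {d} → d ℕ.∣ n → + d ∣ x - y
    d∣x-y d∣n = ∣-trans (∣ᵤ⇒∣ d∣n) n∣x-y

  -- Every divisor of n is coprime to u, so it divides u x only if it divides x.
  w-scale : ∀ n t u x → Coprime ∣ u ∣ n → w n t (u * x) ≡ w n t x
  w-scale n t u x u⊥n = w-cong n t (u * x) x (trans (cong (λ z → gcd z n) (abs-* u x))
    (gcd-ext n (∣ u ∣ ℕ.* ∣ x ∣) ∣ x ∣
      (λ d d∣n d∣ux → coprime-divisor (λ (e∣d , e∣u) → u⊥n (e∣u , ℕ.∣-trans e∣d d∣n)) d∣ux)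
      (λ d d∣n d∣x → ℕ.∣n⇒∣m*n ∣ u ∣ d∣x)))

  -- A divisor d of q m is tested through gcd (d , q) and gcd (d , m), which are coprime and whose
  -- product is a multiple of d.
  w-crt : ∀ q m t x → Coprime q m → w (q ℕ.* m) t x ≡ w q t x * w m t x
  w-crt q m t x q⊥m = ⟦⟧-× (gcdℤ x (q ℕ.* m) ℕ.≟ gcd t (q ℕ.* m)) (gcdℤ x q ℕ.≟ gcd t q) (gcdℤ x m ℕ.≟ gcd t m)
    (λ eq → restrict eq (ℕ.m∣m*n m) , restrict eq (ℕ.n∣m*n q))
    (λ (eq , eq′) → gcd-ext (q ℕ.* m) ∣ x ∣ t (combine eq eq′) (combine (sym eq) (sym eq′)))
    where
    restrict : ∀ {n n′} → gcdℤ x n ≡ gcd t n → n′ ℕ.∣ n → gcdℤ x n′ ≡ gcd t n′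
    restrict {n} {n′} eq n′∣n = gcd-ext n′ ∣ x ∣ t
      (λ d d∣n′ → gcd-∣ {n} {∣ x ∣} {t} eq (ℕ.∣-trans d∣n′ n′∣n))
      (λ d d∣n′ → gcd-∣ {n} {t} {∣ x ∣} (sym eq) (ℕ.∣-trans d∣n′ n′∣n))
    combine : ∀ {x y} → gcd x q ≡ gcd y q → gcd x m ≡ gcd y m → ∀ d → d ℕ.∣ q ℕ.* m → d ℕ.∣ x → d ℕ.∣ y
    combine {x} {y} eq eq′ d d∣qm d∣x = ℕ.∣-trans (∣q*m⇒∣gcd*gcd {q} {m} d∣qm)
      (∣⇒∣ᵤ (coprime⇒*∣ {gcd d q} {gcd d m} {+ y}
        (λ (e∣ , e∣′) → q⊥m (ℕ.∣-trans e∣ (gcd[m,n]∣n d q) , ℕ.∣-trans e∣′ (gcd[m,n]∣n d m)))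
        (∣ᵤ⇒∣ (gcd-∣ {q} {x} {y} eq (gcd[m,n]∣n d q) (ℕ.∣-trans (gcd[m,n]∣m d q) d∣x)))
        (∣ᵤ⇒∣ (gcd-∣ {m} {x} {y} eq′ (gcd[m,n]∣n d m) (ℕ.∣-trans (gcd[m,n]∣m d m) d∣x)))))

  module _ {p} (p-prime : Prime p) (r t : ℕ) where
    private
      -- The extra factor p drives an induction on j: if p ^ (j + 1) divides the shifted value, then
      -- p ^ j ∣ t is already known, so p ^ (j + 1) divides the shift t p z, hence x, hence t.
      gcd-shift : ∀ x z → gcdℤ x (p ℕ.^ r) ≡ gcd t (p ℕ.^ r) →
                  gcdℤ (x + + t * + p * z) (p ℕ.^ r) ≡ gcd t (p ℕ.^ r)
      gcd-shift x z eq = gcd-ext (p ℕ.^ r) ∣ x + + t * + p * z ∣ t forth back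
        where
        p^∣t : ∀ j → j ℕ.≤ r → + (p ℕ.^ j) ∣ x + + t * + p * z → p ℕ.^ j ℕ.∣ t
        p^∣t ℕ.zero    _    _  = ℕ.1∣ t
        p^∣t (ℕ.suc j) 1+j≤r d = gcd-∣ {p ℕ.^ r} {∣ x ∣} {t} eq (^-monoʳ-∣ p 1+j≤r)
          (∣⇒∣ᵤ (∣m+n∣n⇒∣m {m = x} d (∣m⇒∣m*n z (∣-resp (*-comm (+ p) (+ t))
            (∣-trans (∣-reflexive (pos-* p (p ℕ.^ j))) (*-monoʳ-∣ (+ p) (∣ᵤ⇒∣ ih)))))))
          where
          ih : p ℕ.^ j ℕ.∣ t
          ih = p^∣t j (ℕ.<⇒≤ 1+j≤r) (*∣⇒∣ʳ p (p ℕ.^ j) d)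
        forth : ∀ d → d ℕ.∣ p ℕ.^ r → d ℕ.∣ ∣ x + + t * + p * z ∣ → d ℕ.∣ t
        forth d d∣p^r d∣ with ∣p^r⇒≡p^j p-prime r d∣p^r
        ... | j , j≤r , refl = p^∣t j j≤r (∣ᵤ⇒∣ d∣)
        back : ∀ d → d ℕ.∣ p ℕ.^ r → d ℕ.∣ t → d ℕ.∣ ∣ x + + t * + p * z ∣
        back d d∣p^r d∣t = ∣⇒∣ᵤ (∣m∣n⇒∣m+n {+ d} {x}
          (∣ᵤ⇒∣ (gcd-∣ {p ℕ.^ r} {t} {∣ x ∣} (sym eq) d∣p^r d∣t))
          (∣m⇒∣m*n z (∣m⇒∣m*n (+ p) (∣ᵤ⇒∣ {+ d} {+ t} d∣t))))

    w-shift : ∀ x z → w (p ℕ.^ r) t (x + + t * + p * z) ≡ w (p ℕ.^ r) t x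
    w-shift x z = ⟦⟧-cong (gcdℤ (x + + t * + p * z) (p ℕ.^ r) ℕ.≟ gcd t (p ℕ.^ r)) (gcdℤ x (p ℕ.^ r) ℕ.≟ gcd t (p ℕ.^ r))
      -- The converse direction undoes the shift by a second one, with - z.
      (λ eq → subst (λ y → gcdℤ y (p ℕ.^ r) ≡ gcd t (p ℕ.^ r)) (shuffle x (+ t * + p) z)
                (gcd-shift (x + + t * + p * z) (- z) eq))
      (gcd-shift x z)
      where
      shuffle : ∀ x y z → x + y * z + y * - z ≡ x
      shuffle = solve-∀

-- Weighted counts over tuples, and their multiplicativity

module WeightedCounts where
  open ResidueSums
  open import Data.Fin using (Fin; zero; suc)
  open import Data.Integer using (ℤ; +_; _+_; _*_; _-_; -_)
  open import Data.Integer.Divisibility.Signed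
  open import Data.Integer.Properties
  open import Data.Integer.Tactic.RingSolver using (solve-∀)
  open import Data.Nat as ℕ using (ℕ; NonZero)
  open import Data.Nat.Coprimality using (Coprime)
  open import Data.Product using (_,_)
  open import Function using (_∘_)
  open import Relation.Binary.PropositionalEquality

  open import Algebra.Properties.CommutativeMonoid.Sum *-1-commutativeMonoid public
    using () renaming (sum to ∏; sum-cong-≗ to ∏-cong; ∑-distrib-+ to ∏-distrib-*)

  private variable
    k : ℕ

  -- The sum of ∏ᵢ W i (xᵢ) * h (c + ∑ᵢ a i * xᵢ) over x ∈ [0, N)ᵏ.
  count : ℕ → (Fin k → ℤ → ℤ) → (Fin k → ℤ) → (ℤ → ℤ) → ℤ → ℤ
  count {ℕ.zero}  N W a h c = h c
  count {ℕ.suc k} N W a h c = Σ< N (λ x → W zero x * count N (W ∘ suc) (a ∘ suc) h (c + a zero * x))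

  count-cong : ∀ N {W W′ : Fin k → ℤ → ℤ} a {h h′} → (∀ i x → W i x ≡ W′ i x) → (∀ c → h c ≡ h′ c) →
               ∀ c → count N W a h c ≡ count N W′ a h′ c
  count-cong {ℕ.zero}  N a W≗W′ h≗h′ c = h≗h′ c
  count-cong {ℕ.suc k} N a W≗W′ h≗h′ c = Σ<-cong N λ x →
    cong₂ _*_ (W≗W′ zero x) (count-cong N (a ∘ suc) (W≗W′ ∘ suc) h≗h′ (c + a zero * x))

  count-periodic : ∀ N (W : Fin k → ℤ → ℤ) a {q h} → Periodic q h → Periodic q (count N W a h)
  count-periodic {ℕ.zero}  N W a h-per = h-per
  count-periodic {ℕ.suc k} N W a h-per c c′ q∣c-c′ = Σ<-cong N λ x → cong (W zero x *_)
    (count-periodic N (W ∘ suc) (a ∘ suc) h-per _ _ (∣-resp (shuffle c c′ (a zero * x)) q∣c-c′))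
    where
    shuffle : ∀ c c′ y → c - c′ ≡ (c + y) - (c′ + y)
    shuffle = solve-∀

  argument-periodic : ∀ {q} {f : ℤ → ℤ} → Periodic q f → ∀ c a → Periodic q (λ x → f (c + a * x))
  argument-periodic f-per c a x y q∣x-y = f-per _ _ (∣-resp (shuffle c a x y) (∣n⇒∣m*n a q∣x-y))
    where
    shuffle : ∀ c a x y → a * (x - y) ≡ (c + a * x) - (c + a * y)
    shuffle = solve-∀

  *-periodic : ∀ {q f g} → Periodic q f → Periodic q g → Periodic q (λ x → f x * g x)
  *-periodic f-per g-per x y q∣x-y = cong₂ _*_ (f-per x y q∣x-y) (g-per x y q∣x-y)

  -- Once weights and test are split, the summand of each coordinate is a product of a function
  -- periodic modulo q and one periodic modulo m, so `Σ-crt` applies coordinate by coordinate.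
  count-crt : ∀ q m .{{_ : NonZero q}} .{{_ : NonZero m}} → Coprime q m →
              (V W : Fin k → ℤ → ℤ) (a : Fin k → ℤ) {f g : ℤ → ℤ} →
              (∀ i → Periodic q (V i)) → (∀ i → Periodic m (W i)) → Periodic q f → Periodic m g →
              ∀ c → count (q ℕ.* m) (λ i x → V i x * W i x) a (λ x → f x * g x) c
                  ≡ count q V a f c * count m W a g c
  count-crt {ℕ.zero}  q m q⊥m V W a         V-per W-per f-per g-per c = refl
  count-crt {ℕ.suc k} q m q⊥m V W a {f} {g} V-per W-per f-per g-per c = begin
    Σ< (q ℕ.* m) (λ x → V zero x * W zero x
      * count (q ℕ.* m) (λ i x → V (suc i) x * W (suc i) x) (a ∘ suc) (λ x → f x * g x) (c + a zero * x))
      ≡⟨ Σ<-cong (q ℕ.* m) (λ x → trans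
           (cong (V zero x * W zero x *_)
              (count-crt q m q⊥m (V ∘ suc) (W ∘ suc) (a ∘ suc) (V-per ∘ suc) (W-per ∘ suc) f-per g-per (c + a zero * x)))
           (shuffle (V zero x) (W zero x) (F (c + a zero * x)) (G (c + a zero * x)))) ⟩
    Σ< (q ℕ.* m) (λ x → (V zero x * F (c + a zero * x)) * (W zero x * G (c + a zero * x)))
      ≡⟨ Σ-crt q m q⊥m
           (*-periodic (V-per zero) (argument-periodic (count-periodic q (V ∘ suc) (a ∘ suc) f-per) c (a zero)))
           (*-periodic (W-per zero) (argument-periodic (count-periodic m (W ∘ suc) (a ∘ suc) g-per) c (a zero))) ⟩
    Σ< q (λ x → V zero x * F (c + a zero * x)) * Σ< m (λ x → W zero x * G (c + a zero * x)) ∎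
    where
    open ≡-Reasoning
    F G : ℤ → ℤ
    F = count q (V ∘ suc) (a ∘ suc) f
    G = count m (W ∘ suc) (a ∘ suc) g
    shuffle : ∀ v w f g → v * w * (f * g) ≡ (v * f) * (w * g)
    shuffle = solve-∀

  -- Averaging the test over translates commutes with counting. In `count-prime-power` this trades
  -- the test modulo p ^ r for the one modulo p ^ m.
  count-Σ : ∀ N (W : Fin k → ℤ → ℤ) a l (h : ℤ → ℤ) d c →
            count N W a (λ x → Σ< l (λ y → h (x + d * y))) c ≡ Σ< l (λ y → count N W a h (c + d * y))
  count-Σ {ℕ.zero}  N W a l h d c = refl
  count-Σ {ℕ.suc k} N W a l h d c = begin
    Σ< N (λ x → W zero x * count N (W ∘ suc) (a ∘ suc) (λ x → Σ< l (λ y → h (x + d * y))) (c + a zero * x))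
      ≡⟨ Σ<-cong N (λ x → trans
           (cong (W zero x *_) (count-Σ N (W ∘ suc) (a ∘ suc) l h d (c + a zero * x)))
           (Σ<-*ˡ l (W zero x) (λ y → F (c + a zero * x + d * y)))) ⟩
    Σ< N (λ x → Σ< l (λ y → W zero x * F (c + a zero * x + d * y)))
      ≡⟨ Σ<-comm N l (λ x y → W zero x * F (c + a zero * x + d * y)) ⟩
    Σ< l (λ y → Σ< N (λ x → W zero x * F (c + a zero * x + d * y)))
      ≡⟨ Σ<-cong l (λ y → Σ<-cong N (λ x → cong (λ z → W zero x * F z) (shuffle c (a zero * x) (d * y)))) ⟩
    Σ< l (λ y → Σ< N (λ x → W zero x * F (c + d * y + a zero * x))) ∎
    where
    open ≡-Reasoning
    F : ℤ → ℤ
    F = count N (W ∘ suc) (a ∘ suc) h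
    shuffle : ∀ c u v → c + u + v ≡ c + v + u
    shuffle = solve-∀

  ⟦∣⟧-periodic : ∀ q → Periodic q (λ c → ⟦ + q ∣? c ⟧)
  ⟦∣⟧-periodic q c c′ q∣c-c′ = ⟦⟧-cong (+ q ∣? c) (+ q ∣? c′)
    (λ d → ∣-resp (shuffle c c′) (∣m∣n⇒∣m-n d q∣c-c′))
    (λ d → ∣-resp (shuffle′ c c′) (∣m∣n⇒∣m+n d q∣c-c′))
    where
    shuffle : ∀ x y → x - (x - y) ≡ y
    shuffle = solve-∀
    shuffle′ : ∀ x y → y + (x - y) ≡ x
    shuffle′ = solve-∀

  ⟦∣⟧-crt : ∀ q m → Coprime q m → ∀ c → ⟦ + (q ℕ.* m) ∣? c ⟧ ≡ ⟦ + q ∣? c ⟧ * ⟦ + m ∣? c ⟧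
  ⟦∣⟧-crt q m q⊥m c = ⟦⟧-× (+ (q ℕ.* m) ∣? c) (+ q ∣? c) (+ m ∣? c)
    (λ d → *∣⇒∣ q m d , *∣⇒∣ʳ q m d) (λ (q∣c , m∣c) → coprime⇒*∣ q⊥m q∣c m∣c)

-- The number of solutions modulo a prime power

module PrimePowers where
  open ResidueSums
  open Weights
  open WeightedCounts
  open import Data.Fin using (Fin; zero; suc)
  open import Data.Integer using (ℤ; +_; 0ℤ; 1ℤ; -1ℤ; ∣_∣; _+_; _*_; _-_; -_; _^_)
  open import Data.Integer.Divisibility.Signed
  open import Data.Integer.Properties
  open import Data.Integer.Tactic.RingSolver using (solve-∀)
  open import Data.List using ([]; _∷_; length; filter; tabulate; allFin; map)
  open import Data.List.Properties using (map-tabulate; filter-accept; filter-reject)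
  open import Data.Nat as ℕ using (ℕ; NonZero)
  open import Data.Nat.Coprimality as Coprimality using (Coprime; coprime-divisor)
  import Data.Nat.Divisibility as ℕ
  open import Data.Nat.GCD using (gcd)
  open import Data.Nat.Primality using (Prime; prime⇒nonZero)
  import Data.Nat.Properties as ℕ
  open import Data.Product using (_,_; proj₁; proj₂)
  open import Defs using (_∣ℤ?_)
  open import Function using (_∘_; id)
  open import Relation.Binary.PropositionalEquality
  open import Relation.Nullary using (¬_; Dec; yes; no; contradiction; ¬?)
  open import Relation.Unary using (Pred; Decidable)
  open ≡-Reasoning

  private variable
    k : ℕ

  Σ-⟦∣⟧ : ∀ n .{{_ : NonZero n}} → Σ< n (λ y → ⟦ + n ∣? y ⟧) ≡ 1ℤ
  Σ-⟦∣⟧ n = trans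
    (Σ<-cong n (λ y → ⟦⟧-cong (+ n ∣? y) (+ n ∣? 0ℤ - y)
      (λ d → ∣-resp (sym (+-identityˡ (- y))) (∣m⇒∣-m d))
      (λ d → ∣-resp (shuffle y) (∣m⇒∣-m d))))
    (Σ-unit n 0ℤ)
    where
    shuffle : ∀ y → - (0ℤ - y) ≡ y
    shuffle = solve-∀

  Σ-affine-⟦∣⟧ : ∀ n .{{_ : NonZero n}} c i → Coprime ∣ c ∣ n → Σ< n (λ y → ⟦ + n ∣? c * y + i ⟧) ≡ 1ℤ
  Σ-affine-⟦∣⟧ n c i c⊥n = trans (Σ-affine n (⟦∣⟧-periodic n) c i c⊥n) (Σ-⟦∣⟧ n)

  -- Shaped for the induction step of `count-modP`: `A * (B + C * g x)` is the closed form for the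
  -- remaining coordinates, with `g` an indicator.
  Σ-linear : ∀ n (v g : ℤ → ℤ) A B C → Σ< n (λ x → v x * (A * (B + C * g x))) ≡ A * (B * Σ< n v + C * Σ< n (λ x → v x * g x))
  Σ-linear n v g A B C = begin
    Σ< n (λ x → v x * (A * (B + C * g x)))
      ≡⟨ Σ<-cong n (λ x → expand (v x) (g x) A B C) ⟩
    Σ< n (λ x → A * B * v x + A * C * (v x * g x))
      ≡⟨ Σ<-+ n (λ x → A * B * v x) (λ x → A * C * (v x * g x)) ⟩
    Σ< n (λ x → A * B * v x) + Σ< n (λ x → A * C * (v x * g x))
      ≡⟨ cong₂ _+_ (Σ<-*ˡ n (A * B) v) (Σ<-*ˡ n (A * C) (λ x → v x * g x)) ⟨
    A * B * Σ< n v + A * C * Σ< n (λ x → v x * g x)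
      ≡⟨ collect A B C (Σ< n v) (Σ< n (λ x → v x * g x)) ⟩
    A * (B * Σ< n v + C * Σ< n (λ x → v x * g x)) ∎
    where
    expand : ∀ v g A B C → v * (A * (B + C * g)) ≡ A * B * v + A * C * (v * g)
    expand = solve-∀
    collect : ∀ A B C x y → A * B * x + A * C * y ≡ A * (B * x + C * y)
    collect = solve-∀

  -- These count the tuples of the theorem for c = - b when every tᵢ divides n; the
  -- condition gcd (xᵢ , n) = gcd (tᵢ , n) also makes sense for the prime powers in n.
  residues : ∀ n (a : Fin k → ℤ) (t : Fin k → ℕ) → ℤ → ℤ
  residues n a t = count n (λ i → w n (t i)) a (λ c → ⟦ + n ∣? c ⟧)

  -- The number of admissible residues; `Φ≡φ` identifies it with φ (n / t) when t ∣ n.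
  Φ : ℕ → ℕ → ℤ
  Φ n t = Σ< n (w n t)

  -- Spelled like the definition of `e`, so that `e p` is an instance by computation.
  cardinality : ∀ {ℓ} {P : Pred (Fin k) ℓ} → Decidable P → ℕ
  cardinality {k} P? = length (filter P? (allFin k))

  length-filter-map : ∀ {a b p} {A : Set a} {B : Set b} {P : Pred B p} (f : A → B) (P? : Decidable P) xs →
                      length (filter P? (map f xs)) ≡ length (filter (P? ∘ f) xs)
  length-filter-map f P? []       = refl
  length-filter-map f P? (x ∷ xs) with P? (f x)
  ... | yes _ = cong ℕ.suc (length-filter-map f P? xs)
  ... | no  _ = length-filter-map f P? xs

  cardinality-tail : ∀ {ℓ} {P : Pred (Fin (ℕ.suc k)) ℓ} (P? : Decidable P) →
                     length (filter P? (tabulate suc)) ≡ cardinality (P? ∘ suc)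
  cardinality-tail {k} P? = begin
    length (filter P? (tabulate suc))                     ≡⟨ cong (length ∘ filter P?) (map-tabulate id suc) ⟨
    length (filter P? (map suc (allFin k)))               ≡⟨ length-filter-map suc P? (allFin k) ⟩
    cardinality (P? ∘ suc)                                ∎

  cardinality-accept : ∀ {ℓ} {P : Pred (Fin (ℕ.suc k)) ℓ} (P? : Decidable P) → P zero →
                       cardinality P? ≡ ℕ.suc (cardinality (P? ∘ suc))
  cardinality-accept P? P0 = trans (cong length (filter-accept P? P0)) (cong ℕ.suc (cardinality-tail P?))

  cardinality-reject : ∀ {ℓ} {P : Pred (Fin (ℕ.suc k)) ℓ} (P? : Decidable P) → ¬ P zero →
                       cardinality P? ≡ cardinality (P? ∘ suc)
  cardinality-reject P? ¬P0 = trans (cong length (filter-reject P? ¬P0)) (cardinality-tail P?)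

  w-guard : ∀ n t x {y z} → (gcdℤ x n ≡ gcd t n → y ≡ z) → w n t x * y ≡ w n t x * z
  w-guard n t x y≡z = ⟦⟧*-cong (gcdℤ x n ℕ.≟ gcd t n) y≡z

  -- If d ∣ c, exactly one of the l numbers c + d y is divisible by d l; otherwise none is.
  ⟦∣⟧-lift : ∀ d l .{{_ : NonZero d}} .{{_ : NonZero l}} c →
            ⟦ + d ∣? c ⟧ ≡ Σ< l (λ y → ⟦ + (d ℕ.* l) ∣? c + + d * y ⟧)
  ⟦∣⟧-lift d l c = helper (+ d ∣? c)
    where
    factor : ∀ b d y → b * d + d * y ≡ d * (1ℤ * y + b)
    factor = solve-∀
    helper : Dec (+ d ∣ c) → ⟦ + d ∣? c ⟧ ≡ Σ< l (λ y → ⟦ + (d ℕ.* l) ∣? c + + d * y ⟧)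
    helper (no d∤c) = trans (⟦⟧-false (+ d ∣? c) d∤c) (sym (Σ<-0 l (λ y →
      ⟦⟧-false (+ (d ℕ.* l) ∣? c + + d * y)
        (λ dl∣ → d∤c (∣m+n∣n⇒∣m {m = c} (*∣⇒∣ d l dl∣) (∣m⇒∣m*n y ∣-refl))))))
    helper (yes d∣c@(divides b refl)) = trans (⟦⟧-true (+ d ∣? c) d∣c) (sym (trans
      (Σ<-cong l (λ y → ⟦⟧-cong (+ (d ℕ.* l) ∣? c + + d * y) (+ l ∣? 1ℤ * y + b)
        (λ dl∣ → *-cancelˡ-∣ (+ d) (∣-resp (factor b (+ d) y) (∣-trans (∣-reflexive (sym (pos-* d l))) dl∣)))
        (λ l∣ → ∣-resp (sym (factor b (+ d) y)) (∣-trans (∣-reflexive (pos-* d l)) (*-monoʳ-∣ (+ d) l∣)))))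
      (Σ-affine-⟦∣⟧ l 1ℤ b (Coprimality.1-coprimeTo l))))

  module _ {p} (p-prime : Prime p) (r : ℕ) where
    private
      q : ℕ
      q = p ℕ.^ r
      instance
        p≢0 : NonZero p
        p≢0 = prime⇒nonZero p-prime

    count-divisible : ∀ (a : Fin k → ℤ) (t : Fin k → ℕ) → (∀ i → + q ∣ a i * + t i) → ∀ c →
                      residues q a t c ≡ ∏ (λ i → Φ q (t i)) * ⟦ + q ∣? c ⟧
    count-divisible {ℕ.zero}  a t q∣at c = sym (*-identityˡ _)
    count-divisible {ℕ.suc k} a t q∣at c = begin
      Σ< q (λ x → w q (t zero) x * residues q (a ∘ suc) (t ∘ suc) (c + a zero * x))
        ≡⟨ Σ<-cong q (λ x → w-guard q (t zero) x (λ eq → trans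
             (count-divisible (a ∘ suc) (t ∘ suc) (q∣at ∘ suc) (c + a zero * x))
             (cong (Π *_) (sym (⟦∣⟧-periodic q c (c + a zero * x)
               (∣-resp (shuffle c (a zero * x))
                 (∣m⇒∣-m (gcd-∣-*ℤ {q} {q} (a zero) (+ t zero) x (sym eq) ℕ.∣-refl (q∣at zero))))))))) ⟩
      Σ< q (λ x → w q (t zero) x * (Π * ⟦ + q ∣? c ⟧))
        ≡⟨ Σ<-*ʳ q (Π * ⟦ + q ∣? c ⟧) (w q (t zero)) ⟨
      Φ q (t zero) * (Π * ⟦ + q ∣? c ⟧)
        ≡⟨ *-assoc (Φ q (t zero)) Π ⟦ + q ∣? c ⟧ ⟨
      Φ q (t zero) * Π * ⟦ + q ∣? c ⟧ ∎
      where
      Π = ∏ (λ i → Φ q (t (suc i)))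
      shuffle : ∀ c y → - y ≡ c - (c + y)
      shuffle = solve-∀

    module _ (M : ℕ) (M<r : M ℕ.< r) where
      private
        P : ℕ
        P = p ℕ.^ ℕ.suc M

        P∣q : P ℕ.∣ q
        P∣q = ^-monoʳ-∣ p M<r

        instance
          p^M≢0 : NonZero (p ℕ.^ M)
          p^M≢0 = ℕ.m^n≢0 p M
          q≢0 : NonZero q
          q≢0 = ℕ.m^n≢0 p r

        P∣⇒p∣ : ∀ β → + P ∣ β * + (p ℕ.^ M) → + p ∣ β
        P∣⇒p∣ β d = *-cancelʳ-∣ (+ (p ℕ.^ M)) (∣-trans (∣-reflexive (sym (pos-* p (p ℕ.^ M)))) d)

        p∣⇒P∣ : ∀ β → + p ∣ β → + P ∣ β * + (p ℕ.^ M)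
        p∣⇒P∣ β d = ∣-trans (∣-reflexive (pos-* p (p ℕ.^ M))) (*-monoˡ-∣ (+ (p ℕ.^ M)) d)

        ∤⇒coprime : ∀ u → ¬ + p ∣ u → ∀ j → Coprime ∣ u ∣ (p ℕ.^ j)
        ∤⇒coprime u p∤u j = coprime-^ʳ j (Coprimality.sym (prime∧∤⇒coprime p-prime (p∤u ∘ ∣ᵤ⇒∣)))

        E : ℤ
        E = + p - 1ℤ

      Δ : ℤ → ℤ
      Δ c = ⟦ + P ∣? c ⟧

      Δ-periodic : Periodic q Δ
      Δ-periodic x y q∣x-y = ⟦∣⟧-periodic P x y (∣-trans (∣ᵤ⇒∣ P∣q) q∣x-y)

      module _ (a : ℤ) (t : ℕ) (p^M∣at : + (p ℕ.^ M) ∣ a * + t) (P∤at : ¬ + P ∣ a * + t) where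
        private
          -- The contribution of one coordinate with P ∤ a t. For p ^ M ∣ c the aim is that E * f c
          -- is 0 or Φ q t, according to whether P ∣ c.
          f : ℤ → ℤ
          f c = Σ< q (λ x → w q t x * Δ (c + a * x))

          -- From P ∣ c and P ∣ c + a x would follow P ∣ a x, and then P ∣ a t.
          f-divisible : ∀ c → + P ∣ c → f c ≡ 0ℤ
          f-divisible c P∣c = Σ<-0 q λ x → trans
            (w-guard q t x {Δ (c + a * x)} {0ℤ} (λ eq → ⟦⟧-false (+ P ∣? c + a * x) (λ d →
              P∤at (gcd-∣-*ℤ {q} {P} a x (+ t) eq P∣q (∣m+n∣m⇒∣n {m = c} d P∣c)))))
            (*-zeroʳ (w q t x))

          -- The substitution of u x for x preserves admissibility and takes c + a x to a unit
          -- multiple.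
          f-scale : ∀ u c → ¬ + p ∣ u → f (u * c) ≡ f c
          f-scale u c p∤u = begin
            Σ< q (λ x → w q t x * Δ (u * c + a * x))
              ≡⟨ Σ-affine q (*-periodic (w-periodic q t) (argument-periodic Δ-periodic (u * c) a)) u 0ℤ (∤⇒coprime u p∤u r) ⟨
            Σ< q (λ x → w q t (u * x + 0ℤ) * Δ (u * c + a * (u * x + 0ℤ)))
              ≡⟨ Σ<-cong q (λ x → cong₂ _*_
                   (trans (cong (w q t) (+-identityʳ (u * x))) (w-scale q t u x (∤⇒coprime u p∤u r)))
                   (trans (cong Δ (shuffle u c a x)) (Δ-scale (c + a * x)))) ⟩
            f c ∎
            where
            shuffle : ∀ u c a x → u * c + a * (u * x + 0ℤ) ≡ u * (c + a * x)
            shuffle = solve-∀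
            Δ-scale : ∀ c → Δ (u * c) ≡ Δ c
            Δ-scale c = ⟦⟧-cong (+ P ∣? u * c) (+ P ∣? c)
              (λ d → ∣ᵤ⇒∣ (coprime-divisor (Coprimality.sym (∤⇒coprime u p∤u (ℕ.suc M)))
                             (subst (P ℕ.∣_) (abs-* u c) (∣⇒∣ᵤ d))))
              (∣n⇒∣m*n u)

          -- The term u = 0 vanishes because P ∣ u c; each of the other p - 1 values of u is a unit
          -- and contributes f c.
          Σf-by-scaling : ∀ c → + (p ℕ.^ M) ∣ c → Σ< p (λ u → f (u * c)) ≡ E * f c
          Σf-by-scaling c p^M∣c = begin
            Σ< p (λ u → f (u * c))               ≡⟨ Σ<-cong p (λ u → term u (+ p ∣? u)) ⟩
            Σ< p (λ u → (1ℤ - ⟦ + p ∣? u ⟧) * f c) ≡⟨ Σ<-*ʳ p (f c) (λ u → 1ℤ - ⟦ + p ∣? u ⟧) ⟨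
            Σ< p (λ u → 1ℤ - ⟦ + p ∣? u ⟧) * f c ≡⟨ cong (_* f c) units ⟩
            E * f c                              ∎
            where
            term : ∀ u → Dec (+ p ∣ u) → f (u * c) ≡ (1ℤ - ⟦ + p ∣? u ⟧) * f c
            term u (no p∤u) = trans (f-scale u c p∤u) (sym (trans
              (cong (λ z → (1ℤ - z) * f c) (⟦⟧-false (+ p ∣? u) p∤u)) (*-identityˡ (f c))))
            term u (yes p∣u) = trans (f-divisible (u * c) (P∣uc p^M∣c)) (sym (trans
              (cong (λ z → (1ℤ - z) * f c) (⟦⟧-true (+ p ∣? u) p∣u)) (*-zeroˡ (f c))))
              where
              P∣uc : + (p ℕ.^ M) ∣ c → + P ∣ u * c
              P∣uc (divides β refl) = ∣-resp (*-assoc u β (+ (p ℕ.^ M))) (p∣⇒P∣ (u * β) (∣m⇒∣m*n β p∣u))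
            negate : ∀ x → 1ℤ - x ≡ 1ℤ + -1ℤ * x
            negate = solve-∀
            simplify : ∀ p → p * 1ℤ + -1ℤ * 1ℤ ≡ p - 1ℤ
            simplify = solve-∀
            units : Σ< p (λ u → 1ℤ - ⟦ + p ∣? u ⟧) ≡ E
            units = begin
              Σ< p (λ u → 1ℤ - ⟦ + p ∣? u ⟧)
                ≡⟨ Σ<-cong p (λ u → negate ⟦ + p ∣? u ⟧) ⟩
              Σ< p (λ u → 1ℤ + -1ℤ * ⟦ + p ∣? u ⟧)
                ≡⟨ Σ<-+ p (λ _ → 1ℤ) (λ u → -1ℤ * ⟦ + p ∣? u ⟧) ⟩
              Σ< p (λ _ → 1ℤ) + Σ< p (λ u → -1ℤ * ⟦ + p ∣? u ⟧)
                ≡⟨ cong₂ _+_ (Σ<-const p 1ℤ) (trans (sym (Σ<-*ˡ p -1ℤ (λ u → ⟦ + p ∣? u ⟧))) (cong (-1ℤ *_) (Σ-⟦∣⟧ p))) ⟩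
              + p * 1ℤ + -1ℤ * 1ℤ
                ≡⟨ simplify (+ p) ⟩
              E ∎

          -- Here u is summed first. With c = β p ^ M and a x = γ p ^ M the condition becomes β u +
          -- γ ≡ 0 modulo p, and β is a unit, so each admissible x belongs to exactly one u.
          Σf-by-solving : ∀ c → + (p ℕ.^ M) ∣ c → ¬ + P ∣ c → Σ< p (λ u → f (u * c)) ≡ Φ q t
          Σf-by-solving c p^M∣c P∤c = begin
            Σ< p (λ u → Σ< q (λ x → w q t x * Δ (u * c + a * x)))
              ≡⟨ Σ<-comm p q (λ u x → w q t x * Δ (u * c + a * x)) ⟩
            Σ< q (λ x → Σ< p (λ u → w q t x * Δ (u * c + a * x)))
              ≡⟨ Σ<-cong q (λ x → Σ<-*ˡ p (w q t x) (λ u → Δ (u * c + a * x))) ⟨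
            Σ< q (λ x → w q t x * Σ< p (λ u → Δ (u * c + a * x)))
              ≡⟨ Σ<-cong q (λ x → w-guard q t x {Σ< p (λ u → Δ (u * c + a * x))} {1ℤ} (λ eq → solve-for-u p^M∣c
                   (gcd-∣-*ℤ {q} {p ℕ.^ M} a (+ t) x (sym eq) (^-monoʳ-∣ p (ℕ.<⇒≤ M<r)) p^M∣at) P∤c)) ⟩
            Σ< q (λ x → w q t x * 1ℤ)
              ≡⟨ Σ<-cong q (λ x → *-identityʳ (w q t x)) ⟩
            Φ q t ∎
            where
            factor : ∀ u β γ z → u * (β * z) + γ * z ≡ (β * u + γ) * z
            factor = solve-∀
            solve-for-u : ∀ {c y} → + (p ℕ.^ M) ∣ c → + (p ℕ.^ M) ∣ y → ¬ + P ∣ c → Σ< p (λ u → Δ (u * c + y)) ≡ 1ℤ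
            solve-for-u {c} {y} (divides β refl) (divides γ refl) P∤c = trans
              (Σ<-cong p (λ u → ⟦⟧-cong (+ P ∣? u * c + y) (+ p ∣? β * u + γ)
                (λ d → P∣⇒p∣ (β * u + γ) (∣-resp (factor u β γ (+ (p ℕ.^ M))) d))
                (λ d → ∣-resp (sym (factor u β γ (+ (p ℕ.^ M)))) (p∣⇒P∣ (β * u + γ) d))))
              (Σ-affine-⟦∣⟧ p β γ (subst (Coprime ∣ β ∣) (ℕ.*-identityʳ p) (∤⇒coprime β (P∤c ∘ p∣⇒P∣ β) 1)))

        -- Double counting of the pairs (u, x) with u * c + a * x ≡ 0: multiplication
        -- by a unit u permutes the admissible x.
        Σ-head : ∀ c → + (p ℕ.^ M) ∣ c → E * Σ< q (λ x → w q t x * Δ (c + a * x)) ≡ Φ q t * (1ℤ - Δ c)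
        Σ-head c p^M∣c = helper (+ P ∣? c)
          where
          helper : Dec (+ P ∣ c) → E * f c ≡ Φ q t * (1ℤ - Δ c)
          helper (yes P∣c) = trans (trans (cong (E *_) (f-divisible c P∣c)) (*-zeroʳ E))
            (sym (trans (cong (λ z → Φ q t * (1ℤ - z)) (⟦⟧-true (+ P ∣? c) P∣c)) (*-zeroʳ (Φ q t))))
          helper (no P∤c) = trans (trans (sym (Σf-by-scaling c p^M∣c)) (Σf-by-solving c p^M∣c P∤c))
            (sym (trans (cong (λ z → Φ q t * (1ℤ - z)) (⟦⟧-false (+ P ∣? c) P∤c)) (*-identityʳ (Φ q t))))

      Nonzero? : ∀ (a : Fin k → ℤ) (t : Fin k → ℕ) → Decidable (λ i → ¬ P ℕ.∣ ∣ a i * + t i ∣)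
      Nonzero? a t i = ¬? (P ∣ℤ? (a i * + t i))

      -- On functions of c / p ^ M modulo p, a coordinate with P ∤ aᵢ tᵢ acts, up to the factor Φ,
      -- by averaging over the nonzero translates. This fixes constants and multiplies functions of
      -- mean zero by - 1 / (p - 1). Splitting Δ into 1 / p and Δ - 1 / p, and clearing
      -- denominators, gives the closed form.
      count-modP : ∀ (a : Fin k → ℤ) (t : Fin k → ℕ) → (∀ i → + (p ℕ.^ M) ∣ a i * + t i) →
                   let e = cardinality (Nonzero? a t) in ∀ c → + (p ℕ.^ M) ∣ c →
                   + p * E ^ e * count q (λ i → w q (t i)) a Δ c
                   ≡ ∏ (λ i → Φ q (t i)) * (E ^ e - -1ℤ ^ e + + p * -1ℤ ^ e * Δ c)
      count-modP {ℕ.zero}  a t p^M∣at c p^M∣c = base (+ p) (Δ c)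
        where
        base : ∀ p δ → p * 1ℤ * δ ≡ 1ℤ * (1ℤ - 1ℤ + p * 1ℤ * δ)
        base = solve-∀
      count-modP {ℕ.suc k} a t p^M∣at c p^M∣c = helper (+ P ∣? a₀ * + t₀)
        where
        a₀ = a zero
        t₀ = t zero
        v = w q t₀
        Π = ∏ (λ i → Φ q (t (suc i)))
        e = cardinality (Nonzero? (a ∘ suc) (t ∘ suc))
        X = E ^ e
        s = -1ℤ ^ e
        H : ℤ → ℤ
        H = count q (λ i → w q (t (suc i))) (a ∘ suc) Δ
        -- For admissible x the new target c + a₀ x is again divisible by p ^ M, so the closed form
        -- is available for it.
        ih : ∀ x → gcdℤ x q ≡ gcd t₀ q → + p * X * H (c + a₀ * x) ≡ Π * (X - s + + p * s * Δ (c + a₀ * x))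
        ih x eq = count-modP (a ∘ suc) (t ∘ suc) (p^M∣at ∘ suc) (c + a₀ * x)
          (∣m∣n⇒∣m+n p^M∣c (gcd-∣-*ℤ {q} {p ℕ.^ M} a₀ (+ t₀) x (sym eq) (^-monoʳ-∣ p (ℕ.<⇒≤ M<r)) (p^M∣at zero)))

        -- Common to both cases: only the sum of the head coordinate against Δ remains to be
        -- evaluated.
        step : + p * X * Σ< q (λ x → v x * H (c + a₀ * x))
             ≡ Π * ((X - s) * Φ q t₀ + + p * s * Σ< q (λ x → v x * Δ (c + a₀ * x)))
        step = begin
          + p * X * Σ< q (λ x → v x * H (c + a₀ * x))
            ≡⟨ Σ<-*ˡ q (+ p * X) (λ x → v x * H (c + a₀ * x)) ⟩
          Σ< q (λ x → + p * X * (v x * H (c + a₀ * x)))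
            ≡⟨ Σ<-cong q (λ x → trans (swap (+ p * X) (v x) (H (c + a₀ * x)))
                 (w-guard q t₀ x (ih x))) ⟩
          Σ< q (λ x → v x * (Π * (X - s + + p * s * Δ (c + a₀ * x))))
            ≡⟨ Σ-linear q v (λ x → Δ (c + a₀ * x)) Π (X - s) (+ p * s) ⟩
          Π * ((X - s) * Φ q t₀ + + p * s * Σ< q (λ x → v x * Δ (c + a₀ * x))) ∎
          where
          swap : ∀ a b c → a * (b * c) ≡ b * (a * c)
          swap = solve-∀

        -- The exponent is abstracted because the cardinality of the whole family is `e` in one case
        -- and `suc e` in the other.
        Goal : ℕ → Set
        Goal e = + p * E ^ e * Σ< q (λ x → v x * H (c + a₀ * x))
               ≡ Φ q t₀ * Π * (E ^ e - -1ℤ ^ e + + p * -1ℤ ^ e * Δ c)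

        helper : Dec (+ P ∣ a₀ * + t₀) → Goal (cardinality (Nonzero? a t))
        -- P ∣ a₀ x for admissible x, so Δ is constant along the head coordinate and only the factor
        -- Φ q t₀ is gained.
        helper (yes P∣at) = subst Goal (sym (cardinality-reject (Nonzero? a t) (contradiction (∣⇒∣ᵤ P∣at)))) (begin
          + p * X * Σ< q (λ x → v x * H (c + a₀ * x))
            ≡⟨ step ⟩
          Π * ((X - s) * Φ q t₀ + + p * s * Σ< q (λ x → v x * Δ (c + a₀ * x)))
            ≡⟨ cong (λ z → Π * ((X - s) * Φ q t₀ + + p * s * z)) (trans
                 (Σ<-cong q (λ x → w-guard q t₀ x (λ eq → ⟦∣⟧-periodic P (c + a₀ * x) c
                   (∣-resp (cancel c (a₀ * x)) (gcd-∣-*ℤ {q} {P} a₀ (+ t₀) x (sym eq) P∣q P∣at)))))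
                 (sym (Σ<-*ʳ q (Δ c) v))) ⟩
          Π * ((X - s) * Φ q t₀ + + p * s * (Φ q t₀ * Δ c))
            ≡⟨ collect Π (Φ q t₀) (X - s) (+ p * s) (Δ c) ⟩
          Φ q t₀ * Π * (X - s + + p * s * Δ c) ∎)
          where
          cancel : ∀ c y → y ≡ c + y - c
          cancel = solve-∀
          collect : ∀ Π φ A B δ → Π * (A * φ + B * (φ * δ)) ≡ φ * Π * (A + B * δ)
          collect = solve-∀
        -- The additional E on the left is what `Σ-head` consumes. It turns Δ into 1 - Δ, and E (X -
        -- s) + p s (1 - Δ) = E X + s - p s Δ, the closed form with the sign s reversed.
        helper (no P∤at) = subst Goal (sym (cardinality-accept (Nonzero? a t) (P∤at ∘ ∣ᵤ⇒∣))) (begin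
          + p * (E * X) * Σ< q (λ x → v x * H (c + a₀ * x))
            ≡⟨ swap (+ p) E X (Σ< q (λ x → v x * H (c + a₀ * x))) ⟩
          E * (+ p * X * Σ< q (λ x → v x * H (c + a₀ * x)))
            ≡⟨ cong (E *_) step ⟩
          E * (Π * ((X - s) * Φ q t₀ + + p * s * Σ< q (λ x → v x * Δ (c + a₀ * x))))
            ≡⟨ distribute E Π (X - s) (Φ q t₀) (+ p * s) (Σ< q (λ x → v x * Δ (c + a₀ * x))) ⟩
          Π * (E * (X - s) * Φ q t₀ + + p * s * (E * Σ< q (λ x → v x * Δ (c + a₀ * x))))
            ≡⟨ cong (λ z → Π * (E * (X - s) * Φ q t₀ + + p * s * z)) (Σ-head a₀ t₀ (p^M∣at zero) P∤at c p^M∣c) ⟩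
          Π * (E * (X - s) * Φ q t₀ + + p * s * (Φ q t₀ * (1ℤ - Δ c)))
            ≡⟨ collect (+ p) X s Π (Φ q t₀) (Δ c) ⟩
          Φ q t₀ * Π * (E * X - -1ℤ * s + + p * (-1ℤ * s) * Δ c) ∎)
          where
          swap : ∀ p E X S → p * (E * X) * S ≡ E * (p * X * S)
          swap = solve-∀
          distribute : ∀ E Π A φ B S → E * (Π * (A * φ + B * S)) ≡ Π * (E * A * φ + B * (E * S))
          distribute = solve-∀
          collect : ∀ p X s Π φ δ → Π * ((p - 1ℤ) * (X - s) * φ + p * s * (φ * (1ℤ - δ)))
                  ≡ φ * Π * ((p - 1ℤ) * X - -1ℤ * s + p * (-1ℤ * s) * δ)
          collect = solve-∀

      -- Translating a coordinate xᵢ by multiples of tᵢ p preserves gcd (xᵢ , q) and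
      -- moves aᵢ xᵢ by arbitrary multiples of P when P ∤ aᵢ tᵢ.
      residues-shift : ∀ (a : Fin k → ℤ) (t : Fin k → ℕ) → (∀ i → + (p ℕ.^ M) ∣ a i * + t i) →
                       ∀ i → ¬ + P ∣ a i * + t i → ∀ c y →
                       residues q a t (c + + P * y)
                       ≡ residues q a t c
      residues-shift {ℕ.suc k} a t p^M∣at (suc i) P∤at c y = Σ<-cong q λ x → cong (w q (t zero) x *_)
        (trans (cong H (swap c (+ P * y) (a zero * x)))
               (residues-shift (a ∘ suc) (t ∘ suc) (p^M∣at ∘ suc) i P∤at (c + a zero * x) y))
        where
        H : ℤ → ℤ
        H = residues q (a ∘ suc) (t ∘ suc)
        swap : ∀ x y z → x + y + z ≡ x + z + y
        swap = solve-∀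
      residues-shift {ℕ.suc k} a t p^M∣at zero P∤at c y = shift (p^M∣at zero) P∤at
        where
        a₀ = a zero
        t₀ = t zero
        H : ℤ → ℤ
        H = residues q (a ∘ suc) (t ∘ suc)
        H-periodic : Periodic q H
        H-periodic = count-periodic q (λ i → w q (t (suc i))) (a ∘ suc) (⟦∣⟧-periodic q)
        shift : + (p ℕ.^ M) ∣ a₀ * + t₀ → ¬ + P ∣ a₀ * + t₀ →
                Σ< q (λ x → w q t₀ x * H (c + + P * y + a₀ * x)) ≡ Σ< q (λ x → w q t₀ x * H (c + a₀ * x))
        shift (divides α at≡) P∤at = begin
          Σ< q (λ x → w q t₀ x * H (c + + P * y + a₀ * x))
            ≡⟨ Σ-affine q (*-periodic (w-periodic q t₀) (argument-periodic H-periodic (c + + P * y) a₀))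
                 1ℤ (+ t₀ * + p * z) (Coprimality.1-coprimeTo q) ⟨
          Σ< q (λ x → w q t₀ (1ℤ * x + + t₀ * + p * z) * H (c + + P * y + a₀ * (1ℤ * x + + t₀ * + p * z)))
            ≡⟨ Σ<-cong q (λ x → cong₂ _*_
                 (trans (cong (λ x → w q t₀ (x + + t₀ * + p * z)) (*-identityˡ x)) (w-shift p-prime r t₀ x z))
                 (H-periodic _ _ (∣-resp (difference x) (∣n⇒∣m*n (- (+ P * y)) q∣αα′-1)))) ⟩
          Σ< q (λ x → w q t₀ x * H (c + a₀ * x)) ∎
          where
          p∤α : ¬ + p ∣ α
          p∤α p∣α = P∤at (∣-resp (sym at≡) (p∣⇒P∣ α p∣α))
          α-inverse = inverse α q (∤⇒coprime α p∤α r)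
          α′ = proj₁ α-inverse
          q∣αα′-1 = proj₂ α-inverse
          -- As a₀ t₀ = α p ^ M, the shift changes a₀ x by α P z, which for this z is - P y modulo
          -- q.
          z = - (α′ * y)
          expand : ∀ P y c a x t p α′ → c + P * y + a * (1ℤ * x + t * p * - (α′ * y)) - (c + a * x) ≡ P * y - a * t * p * α′ * y
          expand = solve-∀
          contract : ∀ p m y α α′ → p * m * y - α * m * p * α′ * y ≡ - (p * m * y) * (α * α′ - 1ℤ)
          contract = solve-∀
          difference : ∀ x → - (+ P * y) * (α * α′ - 1ℤ) ≡ c + + P * y + a₀ * (1ℤ * x + + t₀ * + p * z) - (c + a₀ * x)
          difference x = sym (begin
            c + + P * y + a₀ * (1ℤ * x + + t₀ * + p * z) - (c + a₀ * x)
              ≡⟨ expand (+ P) y c a₀ x (+ t₀) (+ p) α′ ⟩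
            + P * y - a₀ * + t₀ * + p * α′ * y
              ≡⟨ cong₂ (λ u v → u * y - v * + p * α′ * y) (pos-* p (p ℕ.^ M)) at≡ ⟩
            + p * + (p ℕ.^ M) * y - α * + (p ℕ.^ M) * + p * α′ * y
              ≡⟨ contract (+ p) (+ (p ℕ.^ M)) y α α′ ⟩
            - (+ p * + (p ℕ.^ M) * y) * (α * α′ - 1ℤ)
              ≡⟨ cong (λ u → - (u * y) * (α * α′ - 1ℤ)) (pos-* p (p ℕ.^ M)) ⟨
            - (+ P * y) * (α * α′ - 1ℤ) ∎)

      -- By `residues-shift` all l = p ^ (r - m) targets c + P y have equally many solutions, and by
      -- `⟦∣⟧-lift` their tests modulo q add up to the test modulo P. So l times the count is the
      -- one in `count-modP`; the other factor p of p ^ (r - M) is already there.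
      count-prime-power : ∀ (a : Fin k → ℤ) (t : Fin k → ℕ) → (∀ i → + (p ℕ.^ M) ∣ a i * + t i) →
                          ∀ i → ¬ + P ∣ a i * + t i →
                          let e = cardinality (Nonzero? a t) in ∀ c → + (p ℕ.^ M) ∣ c →
                          + (p ℕ.^ (r ℕ.∸ M)) * E ^ e * residues q a t c
                          ≡ ∏ (λ i → Φ q (t i)) * (E ^ e - -1ℤ ^ e + + p * -1ℤ ^ e * Δ c)
      count-prime-power a t p^M∣at i P∤at c p^M∣c = trans (begin
        + (p ℕ.^ (r ℕ.∸ M)) * E ^ e * N c
          ≡⟨ cong (λ z → z * E ^ e * N c) (trans (cong (λ j → + (p ℕ.^ j)) (ℕ.+-∸-assoc 1 M<r)) (pos-* p l)) ⟩
        + p * + l * E ^ e * N c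
          ≡⟨ swap (+ p) (+ l) (E ^ e) (N c) ⟩
        + p * E ^ e * (+ l * N c)
          ≡⟨ cong (+ p * E ^ e *_) average ⟩
        + p * E ^ e * count q (λ i → w q (t i)) a Δ c ∎)
        (count-modP a t p^M∣at c p^M∣c)
        where
        e = cardinality (Nonzero? a t)
        l = p ℕ.^ (r ℕ.∸ ℕ.suc M)
        N : ℤ → ℤ
        N = residues q a t
        swap : ∀ p l X N → p * l * X * N ≡ p * X * (l * N)
        swap = solve-∀
        instance
          P≢0 : NonZero P
          P≢0 = ℕ.m^n≢0 p (ℕ.suc M)
          l≢0 : NonZero l
          l≢0 = ℕ.m^n≢0 p (r ℕ.∸ ℕ.suc M)
        Pl≡q : P ℕ.* l ≡ q
        Pl≡q = trans (sym (ℕ.^-distribˡ-+-* p (ℕ.suc M) (r ℕ.∸ ℕ.suc M))) (cong (p ℕ.^_) (ℕ.m+[n∸m]≡n M<r))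
        average : + l * N c ≡ count q (λ i → w q (t i)) a Δ c
        average = begin
          + l * N c
            ≡⟨ Σ<-const l (N c) ⟨
          Σ< l (λ _ → N c)
            ≡⟨ Σ<-cong l (λ y → residues-shift a t p^M∣at i P∤at c y) ⟨
          Σ< l (λ y → N (c + + P * y))
            ≡⟨ count-Σ q (λ i → w q (t i)) a l (λ c → ⟦ + q ∣? c ⟧) (+ P) c ⟨
          count q (λ i → w q (t i)) a (λ c → Σ< l (λ y → ⟦ + q ∣? c + + P * y ⟧)) c
            ≡⟨ count-cong q a (λ _ _ → refl) (λ c → trans (⟦∣⟧-lift P l c)
                 (cong (λ q → Σ< l (λ y → ⟦ + q ∣? c + + P * y ⟧)) Pl≡q)) c ⟨
          count q (λ i → w q (t i)) a Δ c ∎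

-- The list enumerations behind `φ` and `numberOfSolutions` as sums over residues

module Counting where
  open ResidueSums
  open Weights
  open WeightedCounts
  open PrimePowers
  open import Data.Fin using (Fin; zero; suc; toℕ; finToFun; combine; remQuot; _↑ˡ_; _↑ʳ_)
  open import Data.Fin.Properties using (all?; remQuot-combine)
  open import Data.Integer using (ℤ; +_; 1ℤ; ∣_∣; _+_; _*_; _-_; -_)
  open import Data.Integer.Divisibility.Signed
  open import Data.Integer.Properties
  open import Data.Integer.Tactic.RingSolver using (solve-∀)
  open import Data.List using (List; _∷_; length; filter; tabulate; applyUpTo)
  open import Data.List.Properties using (map-tabulate; map-applyUpTo)
  open import Data.Nat as ℕ using (ℕ; NonZero)
  open import Data.Nat.Coprimality as Coprimality using (coprime?; coprime⇒gcd≡1; gcd≡1⇒coprime)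
  import Data.Nat.Divisibility as ℕ
  open import Data.Nat.DivMod using (m*[n/m]≡n)
  open import Data.Nat.GCD
  import Data.Nat.Properties as ℕ
  open import Data.Product using (_×_; _,_)
  open import Defs using (φ; ∑ℤ; module Congruence)
  open import Function using (_∘_; id)
  open import Relation.Binary.PropositionalEquality
  open import Relation.Nullary using (Dec; yes; no)
  open import Relation.Unary using (Pred; Decidable)
  open ≡-Reasoning

  length-filter-∷ : ∀ {ℓ ℓ′} {A : Set ℓ} {P : Pred A ℓ′} (P? : Decidable P) x xs →
                    + length (filter P? (x ∷ xs)) ≡ ⟦ P? x ⟧ + + length (filter P? xs)
  length-filter-∷ P? x xs with P? x
  ... | yes p = cong (_+ + length (filter P? xs)) (sym (⟦⟧-true (yes p) p))
  ... | no ¬p = trans (sym (+-identityˡ _)) (cong (_+ + length (filter P? xs)) (sym (⟦⟧-false (no ¬p) ¬p)))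

  length-filter-tabulate : ∀ {ℓ ℓ′} {A : Set ℓ} {P : Pred A ℓ′} (P? : Decidable P) n (f : Fin n → A) →
                           + length (filter P? (tabulate f)) ≡ sum (λ i → ⟦ P? (f i) ⟧)
  length-filter-tabulate P? ℕ.zero    f = refl
  length-filter-tabulate P? (ℕ.suc n) f = trans (length-filter-∷ P? (f zero) (tabulate (f ∘ suc)))
    (cong (λ z → ⟦ P? (f zero) ⟧ + z) (length-filter-tabulate P? n (f ∘ suc)))

  applyUpTo≡tabulate : ∀ {ℓ} {A : Set ℓ} (f : ℕ → A) n → applyUpTo f n ≡ tabulate {n = n} (f ∘ toℕ)
  applyUpTo≡tabulate f ℕ.zero    = refl
  applyUpTo≡tabulate f (ℕ.suc n) = cong (f 0 ∷_) (applyUpTo≡tabulate (f ∘ ℕ.suc) n)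

  opaque
    unfolding Σ<

    Σ<-length : ∀ {ℓ} {P : Pred ℕ ℓ} (P? : Decidable P) n (f : ℕ → ℕ) (g : ℤ → ℤ) →
                (∀ j → ⟦ P? (f j) ⟧ ≡ g (+ j)) → + length (filter P? (applyUpTo f n)) ≡ Σ< n g
    Σ<-length P? n f g P≗g = trans (cong (λ xs → + length (filter P? xs)) (applyUpTo≡tabulate f n))
      (trans (length-filter-tabulate P? n (f ∘ toℕ)) (sum-cong-≗ {n} (P≗g ∘ toℕ)))

    -- Exports the definition of the opaque `Σ<` as an equation, for use in `count-finToFun`.
    Σ<-unfold : ∀ n g → Σ< n g ≡ sum {n} (λ j → g (+ toℕ j))
    Σ<-unfold n g = refl

  -- The x with gcd (x , t m) = t are the t j with gcd (j , m) = 1. The bijection is expressed as a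
  -- double sum over x and j with the bracket of t j ≡ x.
  Φ-scale : ∀ m t .{{_ : NonZero m}} .{{_ : NonZero t}} → Φ (t ℕ.* m) t ≡ Φ m 1
  Φ-scale m t = begin
    Σ< n (w n t)
      ≡⟨ Σ<-cong n (λ x → split x (+ t ∣? x)) ⟩
    Σ< n (λ x → Σ< m (λ j → ⟦ + n ∣? + t * j - x ⟧ * w m 1 j))
      ≡⟨ Σ<-comm n m (λ x j → ⟦ + n ∣? + t * j - x ⟧ * w m 1 j) ⟩
    Σ< m (λ j → Σ< n (λ x → ⟦ + n ∣? + t * j - x ⟧ * w m 1 j))
      ≡⟨ Σ<-cong m (λ j → Σ<-*ʳ n (w m 1 j) (λ x → ⟦ + n ∣? + t * j - x ⟧)) ⟨
    Σ< m (λ j → Σ< n (λ x → ⟦ + n ∣? + t * j - x ⟧) * w m 1 j)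
      ≡⟨ Σ<-cong m (λ j → trans (cong (_* w m 1 j) (Σ-unit n (+ t * j))) (*-identityˡ (w m 1 j))) ⟩
    Φ m 1 ∎
    where
    n = t ℕ.* m
    instance
      n≢0 : NonZero n
      n≢0 = ℕ.m*n≢0 t m
    gcd[t,n]≡t : gcd t n ≡ t
    gcd[t,n]≡t = ℕ.∣-antisym (gcd[m,n]∣m t n) (gcd-greatest ℕ.∣-refl (ℕ.m∣m*n m))
    gcd-factor : ∀ y → gcdℤ (y * + t) n ≡ t ℕ.* gcdℤ y m
    gcd-factor y = trans (cong (λ z → gcd z n) (trans (abs-* y (+ t)) (ℕ.*-comm ∣ y ∣ t)))
                         (sym (c*gcd[m,n]≡gcd[cm,cn] t ∣ y ∣ m))
    factor : ∀ t y j → t * j - y * t ≡ t * - (y - j)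
    factor = solve-∀
    negate : ∀ y j → - - (y - j) ≡ y - j
    negate = solve-∀
    split : ∀ x → Dec (+ t ∣ x) → w n t x ≡ Σ< m (λ j → ⟦ + n ∣? + t * j - x ⟧ * w m 1 j)
    split x (no t∤x) = trans
      (⟦⟧-false (gcdℤ x n ℕ.≟ gcd t n) (λ eq → t∤x (∣ᵤ⇒∣ (subst (ℕ._∣ ∣ x ∣) (trans eq gcd[t,n]≡t) (gcd[m,n]∣m (∣ x ∣) n)))))
      (sym (Σ<-0 m (λ j → trans (cong (_* w m 1 j) (⟦⟧-false (+ n ∣? + t * j - x) (λ d →
        t∤x (∣-resp (cancel (+ t * j) x) (∣m∣n⇒∣m-n (∣m⇒∣m*n j ∣-refl) (*∣⇒∣ t m d))))))
        (*-zeroˡ (w m 1 j)))))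
      where
      cancel : ∀ y x → y - (y - x) ≡ x
      cancel = solve-∀
    split x (yes (divides y refl)) = trans
      (⟦⟧-cong (gcdℤ x n ℕ.≟ gcd t n) (gcdℤ y m ℕ.≟ gcd 1 m)
        (λ eq → trans (ℕ.*-cancelˡ-≡ (gcdℤ y m) 1 t
          (trans (sym (gcd-factor y)) (trans eq (trans gcd[t,n]≡t (sym (ℕ.*-identityʳ t)))))) (sym (gcd-zeroˡ m)))
        (λ eq → trans (gcd-factor y) (trans (cong (t ℕ.*_) (trans eq (gcd-zeroˡ m))) (trans (ℕ.*-identityʳ t) (sym gcd[t,n]≡t)))))
      (trans (sym (Σ-pick m (w-periodic m 1) y)) (Σ<-cong m (λ j → cong (_* w m 1 j) (⟦⟧-cong (+ m ∣? y - j) (+ n ∣? + t * j - x)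
        (λ d → ∣-resp (sym (factor (+ t) y j)) (∣-trans (∣-reflexive (pos-* t m)) (*-monoʳ-∣ (+ t) (∣m⇒∣-m d))))
        (λ d → ∣-resp (negate y j) (∣m⇒∣-m (*-cancelˡ-∣ (+ t)
          (∣-resp (factor (+ t) y j) (∣-trans (∣-reflexive (sym (pos-* t m))) d)))))))))

  Φ≡φ : ∀ n t .{{_ : NonZero n}} .{{t>0 : NonZero t}} → t ℕ.∣ n → Φ n t ≡ + φ (n ℕ./ t)
  Φ≡φ n t t∣n = begin
    Φ n t                                ≡⟨ cong (λ n → Φ n t) n≡tm ⟩
    Φ (t ℕ.* m) t                        ≡⟨ Φ-scale m t ⟩
    -- `φ` enumerates 1, ..., m but `Σ<` runs over 0, ..., m - 1; periodicity absorbs the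
    -- translation by 1.
    Σ< m (w m 1)                         ≡⟨ Σ-affine m (w-periodic m 1) 1ℤ 1ℤ (Coprimality.1-coprimeTo m) ⟨
    Σ< m (λ j → w m 1 (1ℤ * j + 1ℤ))     ≡⟨ Σ<-length (λ j → coprime? j m) m ℕ.suc (λ j → w m 1 (1ℤ * j + 1ℤ)) term ⟨
    + length (filter (λ j → coprime? j m) (applyUpTo ℕ.suc m))
      ≡⟨ cong (λ xs → + length (filter (λ j → coprime? j m) xs)) (map-applyUpTo id ℕ.suc m) ⟨
    + φ m                                ∎
    where
    m = n ℕ./ t
    n≡tm : n ≡ t ℕ.* m
    n≡tm = sym (m*[n/m]≡n t∣n)
    instance
      m≢0 : NonZero m
      m≢0 = ℕ.≢-nonZero (λ m≡0 → ℕ.≢-nonZero⁻¹ n (trans n≡tm (trans (cong (t ℕ.*_) m≡0) (ℕ.*-zeroʳ t))))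
    term : ∀ j → ⟦ coprime? (ℕ.suc j) m ⟧ ≡ w m 1 (1ℤ * + j + 1ℤ)
    term j = ⟦⟧-cong (coprime? (ℕ.suc j) m) (gcdℤ (1ℤ * + j + 1ℤ) m ℕ.≟ gcd 1 m)
      (λ j⊥m → trans (cong (λ x → gcdℤ x m) 1*j+1≡1+j) (trans (coprime⇒gcd≡1 j⊥m) (sym (gcd-zeroˡ m))))
      (λ eq → gcd≡1⇒coprime (trans (cong (λ x → gcdℤ x m) (sym 1*j+1≡1+j)) (trans eq (gcd-zeroˡ m))))
      where
      1*j+1≡1+j : 1ℤ * + j + 1ℤ ≡ + ℕ.suc j
      1*j+1≡1+j = trans (cong (_+ 1ℤ) (*-identityˡ (+ j))) (+-comm (+ j) 1ℤ)

  sum-↑ : ∀ m n (f : Fin (m ℕ.+ n) → ℤ) → sum f ≡ sum (λ i → f (i ↑ˡ n)) + sum (λ j → f (m ↑ʳ j))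
  sum-↑ ℕ.zero    n f = sym (+-identityˡ (sum f))
  sum-↑ (ℕ.suc m) n f = trans (cong (λ z → f zero + z) (sum-↑ m n (f ∘ suc)))
                              (sym (+-assoc (f zero) (sum (λ i → f (suc i ↑ˡ n))) (sum (λ j → f (ℕ.suc m ↑ʳ j)))))

  sum-combine : ∀ m n (f : Fin (m ℕ.* n) → ℤ) → sum f ≡ sum {m} (λ i → sum {n} (λ j → f (combine i j)))
  sum-combine ℕ.zero    n f = refl
  sum-combine (ℕ.suc m) n f = trans (sum-↑ n (m ℕ.* n) f)
    (cong (λ z → sum (λ j → f (j ↑ˡ (m ℕ.* n))) + z) (sum-combine m n (λ i → f (n ↑ʳ i))))

  -- `finToFun` decodes its index by `remQuot`, so this separates the first coordinate in a sum over
  -- all tuples.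
  sum-remQuot : ∀ m n (f : Fin m × Fin n → ℤ) →
                sum {m ℕ.* n} (λ i → f (remQuot n i)) ≡ sum {m} (λ i → sum {n} (λ j → f (i , j)))
  sum-remQuot m n f = trans (sum-combine m n (λ i → f (remQuot n i)))
    (sum-cong-≗ {m} (λ i → sum-cong-≗ {n} (λ j → cong f (remQuot-combine i j))))

  ⟦all?⟧ : ∀ {k ℓ} {P : Pred (Fin k) ℓ} (P? : Decidable P) (∀P? : Dec (∀ i → P i)) →
           ⟦ ∀P? ⟧ ≡ ∏ (λ i → ⟦ P? i ⟧)
  ⟦all?⟧ {ℕ.zero}  P? ∀P? = ⟦⟧-true ∀P? (λ ())
  ⟦all?⟧ {ℕ.suc k} P? ∀P? = trans
    (⟦⟧-× ∀P? (P? zero) (all? (P? ∘ suc)) (λ ∀P → ∀P zero , ∀P ∘ suc) (λ { (P0 , _) zero → P0 ; (_ , P+) (suc i) → P+ i }))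
    (cong (⟦ P? zero ⟧ *_) (⟦all?⟧ (P? ∘ suc) (all? (P? ∘ suc))))

  -- Matches the flat enumeration of tuples with the recursion of `count`: reassociating the sum
  -- moves a₀ x₀ into the accumulator c.
  count-finToFun : ∀ {k} n (W : Fin k → ℤ → ℤ) (a : Fin k → ℤ) (h : ℤ → ℤ) c →
                   sum {n ℕ.^ k} (λ j → let x = finToFun {n} {k} j in
                     ∏ (λ i → W i (+ toℕ (x i))) * h (c + ∑ℤ (λ i → a i * + toℕ (x i))))
                   ≡ count n W a h c
  count-finToFun {ℕ.zero}  n W a h c = trans (+-identityʳ _) (trans (*-identityˡ _) (cong h (+-identityʳ c)))
  count-finToFun {ℕ.suc k} n W a h c = begin
    sum {n ℕ.* n ℕ.^ k} (λ j → let x = finToFun {n} {ℕ.suc k} j in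
      ∏ (λ i → W i (+ toℕ (x i))) * h (c + ∑ℤ (λ i → a i * + toℕ (x i))))
      ≡⟨ sum-remQuot n (n ℕ.^ k) (λ (x₀ , j) →
           W zero (+ toℕ x₀) * Π j * h (c + (a zero * + toℕ x₀ + S j))) ⟩
    sum {n} (λ x₀ → sum {n ℕ.^ k} (λ j → W zero (+ toℕ x₀) * Π j * h (c + (a zero * + toℕ x₀ + S j))))
      ≡⟨ sum-cong-≗ {n} (λ x₀ → trans
           (sum-cong-≗ {n ℕ.^ k} (λ j → trans
             (cong (λ z → W zero (+ toℕ x₀) * Π j * h z) (sym (+-assoc c (a zero * + toℕ x₀) (S j))))
             (*-assoc (W zero (+ toℕ x₀)) (Π j) (h (c + a zero * + toℕ x₀ + S j)))))
           (trans (sym (*-distribˡ-sum {n ℕ.^ k} (W zero (+ toℕ x₀)) (λ j → Π j * h (c + a zero * + toℕ x₀ + S j))))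
             (cong (W zero (+ toℕ x₀) *_) (count-finToFun n (W ∘ suc) (a ∘ suc) h (c + a zero * + toℕ x₀))))) ⟩
    sum {n} (λ x₀ → W zero (+ toℕ x₀) * count n (W ∘ suc) (a ∘ suc) h (c + a zero * + toℕ x₀))
      ≡⟨ Σ<-unfold n (λ x₀ → W zero x₀ * count n (W ∘ suc) (a ∘ suc) h (c + a zero * x₀)) ⟨
    count n W a h c ∎
    where
    Π S : Fin (n ℕ.^ k) → ℤ
    Π j = ∏ (λ i → W (suc i) (+ toℕ (finToFun {n} {k} j i)))
    S j = ∑ℤ (λ i → a (suc i) * + toℕ (finToFun {n} {k} j i))

  module _ {k : ℕ} (n : ℕ) .{{_ : NonZero n}} (a : Fin k → ℤ) (b : ℤ) (t : Fin k → ℕ) where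
    open Congruence n a b t

    numberOfSolutions≡residues : (∀ i → t i ℕ.∣ n) → + numberOfSolutions ≡ residues n a t (- b)
    numberOfSolutions≡residues t∣n = begin
      + numberOfSolutions
        ≡⟨ cong (λ xs → + length (filter isSolution? xs)) (map-tabulate {n = n ℕ.^ k} id finToFun) ⟩
      + length (filter isSolution? (tabulate {n = n ℕ.^ k} finToFun))
        ≡⟨ length-filter-tabulate isSolution? (n ℕ.^ k) finToFun ⟩
      sum {n ℕ.^ k} (λ j → ⟦ isSolution? (finToFun j) ⟧)
        ≡⟨ sum-cong-≗ {n ℕ.^ k} (λ j → indicator (finToFun j)) ⟩
      sum {n ℕ.^ k} (λ j → let x = finToFun {n} {k} j in
        ∏ (λ i → w n (t i) (+ toℕ (x i))) * ⟦ + n ∣? - b + ∑ℤ (λ i → a i * + toℕ (x i)) ⟧)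
        ≡⟨ count-finToFun n (λ i → w n (t i)) a (λ c → ⟦ + n ∣? c ⟧) (- b) ⟩
      residues n a t (- b) ∎
      where
      gcd[t,n]≡t : ∀ i → gcd (t i) n ≡ t i
      gcd[t,n]≡t i = ℕ.∣-antisym (gcd[m,n]∣m (t i) n) (gcd-greatest ℕ.∣-refl (t∣n i))
      indicator : ∀ x → ⟦ isSolution? x ⟧
                ≡ ∏ (λ i → w n (t i) (+ toℕ (x i))) * ⟦ + n ∣? - b + ∑ℤ (λ i → a i * + toℕ (x i)) ⟧
      indicator x = trans
        (⟦⟧-× (isSolution? x) gcds? (+ n ∣? - b + ∑ℤ (λ i → a i * + toℕ (x i)))
          (λ (d , eqs) → (λ i → trans (eqs i) (sym (gcd[t,n]≡t i))) , ∣-resp (+-comm (∑ℤ (λ i → a i * + toℕ (x i))) (- b)) (∣ᵤ⇒∣ d))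
          (λ (eqs , d) → ∣⇒∣ᵤ (∣-resp (+-comm (- b) (∑ℤ (λ i → a i * + toℕ (x i)))) d) , λ i → trans (eqs i) (gcd[t,n]≡t i)))
        (cong (_* ⟦ + n ∣? - b + ∑ℤ (λ i → a i * + toℕ (x i)) ⟧)
          (⟦all?⟧ (λ i → gcdℤ (+ toℕ (x i)) n ℕ.≟ gcd (t i) n) gcds?))
        where
        gcds? : Dec (∀ i → gcdℤ (+ toℕ (x i)) n ≡ gcd (t i) n)
        gcds? = all? (λ i → gcdℤ (+ toℕ (x i)) n ℕ.≟ gcd (t i) n)

-- Passing from n to the prime powers in n

module PrimeFactorisations where
  open ResidueSums
  open Weights
  open WeightedCounts
  open PrimePowers
  open import Data.Fin using (Fin; zero; suc)
  open import Data.Integer using (ℤ; +_; 1ℤ; ∣_∣; _+_; _*_)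
  open import Data.Integer.Divisibility.Signed
  open import Data.Integer.Properties
  open import Data.List using (List; []; _∷_; length; filter; map; foldr; upTo)
  open import Data.List.Properties using (filter-accept; filter-reject)
  open import Data.List.Membership.Propositional using (_∈_)
  open import Data.List.Membership.Propositional.Properties using (∈-filter⁺; ∈-filter⁻; ∈-upTo⁺)
  open import Data.List.Relation.Unary.All as All using (All; []; _∷_)
  open import Data.List.Relation.Unary.AllPairs using ([]; _∷_)
  open import Data.List.Relation.Unary.Any using (here; there)
  open import Data.List.Relation.Unary.Unique.Propositional using (Unique)
  open import Data.List.Relation.Unary.Unique.Propositional.Properties using (upTo⁺; filter⁺)
  open import Data.Nat as ℕ using (ℕ; NonZero)
  open import Data.Nat.Coprimality as Coprimality using (Coprime)
  import Data.Nat.Divisibility as ℕ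
  open import Data.Nat.GCD using (gcd-zeroʳ)
  open import Data.Nat.ListAction using (product)
  open import Data.Nat.ListAction.Properties using (∈⇒∣product)
  open import Data.Nat.Primality using (Prime; prime?; prime⇒nonZero; prime⇒irreducible; ¬prime[1])
  open import Data.Nat.Primality.Factorisation using (PrimeFactorisation; factorise)
  import Data.Nat.Properties as ℕ
  open import Data.Product using (_×_; _,_; proj₁; proj₂)
  open import Data.Sum using (inj₁; inj₂)
  open import Defs using (primeDivisors)
  open import Function using (_∘_)
  open import Relation.Binary.PropositionalEquality
  open import Relation.Nullary using (¬_)
  open import Relation.Nullary.Decidable using (_×-dec_)
  open ≡-Reasoning

  private variable
    k : ℕ

  primes-coprime : ∀ {p p′} → Prime p → Prime p′ → p ≢ p′ → Coprime p p′
  primes-coprime {p} {p′} p-prime p′-prime p≢p′ = prime∧∤⇒coprime p-prime p∤p′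
    where
    p∤p′ : ¬ p ℕ.∣ p′
    p∤p′ p∣p′ with prime⇒irreducible p′-prime p∣p′
    ... | inj₁ refl = ¬prime[1] p-prime
    ... | inj₂ p≡p′ = p≢p′ p≡p′

  ∏L : List ℕ → (ℕ → ℤ) → ℤ
  ∏L ps f = foldr _*_ 1ℤ (map f ps)

  w-1 : ∀ t x → w 1 t x ≡ 1ℤ
  w-1 t x = ⟦⟧-true (gcdℤ x 1 ℕ.≟ _) (trans (gcd-zeroʳ (∣ x ∣)) (sym (gcd-zeroʳ t)))

  residues-1 : ∀ (a : Fin k → ℤ) t c → residues 1 a t c ≡ 1ℤ
  residues-1 {ℕ.zero}  a t c = ⟦⟧-true (+ 1 ∣? c) (∣ᵤ⇒∣ (ℕ.1∣ ∣ c ∣))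
  residues-1 {ℕ.suc k} a t c = trans
    (Σ<-cong 1 (λ x → cong₂ _*_ (w-1 (t zero) x) (residues-1 (a ∘ suc) (t ∘ suc) (c + a zero * x))))
    (Σ<-const 1 1ℤ)

  module _ (r : ℕ → ℕ) where
    pp : ℕ → ℕ
    pp p = p ℕ.^ r p

    -- The exponents are arbitrary, since in the proof of `factorisation` they vary with the list of
    -- factors.
    ∏^ : List ℕ → ℕ
    ∏^ ps = product (map pp ps)

    ∏^≢0 : ∀ {ps} → All Prime ps → NonZero (∏^ ps)
    ∏^≢0 []                   = _
    ∏^≢0 (_∷_ {p} p-prime ps) = ℕ.m*n≢0 (pp p) _ {{ℕ.m^n≢0 p (r p) {{prime⇒nonZero p-prime}}}} {{∏^≢0 ps}}

    coprime-∏^ : ∀ {p ps} → Prime p → All Prime ps → All (p ≢_) ps → Coprime (pp p) (∏^ ps)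
    coprime-∏^ p-prime []                 []             = Coprimality.sym (Coprimality.1-coprimeTo _)
    coprime-∏^ {p} {p′ ∷ ps} p-prime (p′-prime ∷ primes) (p≢p′ ∷ p∉ps) = coprime-*ʳ {pp p} {pp p′} {∏^ ps}
      (coprime-^ʳ (r p′) (Coprimality.sym (coprime-^ʳ (r p) (Coprimality.sym (primes-coprime p-prime p′-prime p≢p′)))))
      (coprime-∏^ p-prime primes p∉ps)

    Φ-factorise : ∀ t {ps} → Unique ps → All Prime ps → Φ (∏^ ps) t ≡ ∏L ps (λ p → Φ (pp p) t)
    Φ-factorise t []            []                   = trans (Σ<-cong 1 (w-1 t)) (Σ<-const 1 1ℤ)
    Φ-factorise t {p ∷ ps} (p∉ps ∷ unique) (p-prime ∷ primes) = begin
      Φ (pp p ℕ.* ∏^ ps) t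
        ≡⟨ Σ<-cong (pp p ℕ.* ∏^ ps) (λ x → w-crt (pp p) (∏^ ps) t x p⊥ps) ⟩
      Σ< (pp p ℕ.* ∏^ ps) (λ x → w (pp p) t x * w (∏^ ps) t x)
        ≡⟨ Σ-crt (pp p) (∏^ ps) p⊥ps (w-periodic (pp p) t) (w-periodic (∏^ ps) t) ⟩
      Φ (pp p) t * Φ (∏^ ps) t
        ≡⟨ cong (Φ (pp p) t *_) (Φ-factorise t unique primes) ⟩
      Φ (pp p) t * ∏L ps (λ p → Φ (pp p) t) ∎
      where
      p⊥ps = coprime-∏^ p-prime primes p∉ps
      instance
        _ = ∏^≢0 primes
        _ = ℕ.m^n≢0 p (r p) {{prime⇒nonZero p-prime}}

    -- Weights and test both split along the coprime factors `pp p` and `∏^ ps`, which is what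
    -- `count-crt` asks for.
    residues-factorise : ∀ (a : Fin k → ℤ) t c {ps} → Unique ps → All Prime ps →
                         residues (∏^ ps) a t c ≡ ∏L ps (λ p → residues (pp p) a t c)
    residues-factorise a t c []            []                   = residues-1 a t c
    residues-factorise a t c {p ∷ ps} (p∉ps ∷ unique) (p-prime ∷ primes) = begin
      residues (pp p ℕ.* ∏^ ps) a t c
        ≡⟨ count-cong (pp p ℕ.* ∏^ ps) a
             (λ i x → w-crt (pp p) (∏^ ps) (t i) x p⊥ps) (⟦∣⟧-crt (pp p) (∏^ ps) p⊥ps) c ⟩
      count (pp p ℕ.* ∏^ ps) (λ i x → w (pp p) (t i) x * w (∏^ ps) (t i) x) a
        (λ c → ⟦ + pp p ∣? c ⟧ * ⟦ + ∏^ ps ∣? c ⟧) c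
        ≡⟨ count-crt (pp p) (∏^ ps) p⊥ps (λ i → w (pp p) (t i)) (λ i → w (∏^ ps) (t i)) a
             (λ i → w-periodic (pp p) (t i)) (λ i → w-periodic (∏^ ps) (t i)) (⟦∣⟧-periodic (pp p)) (⟦∣⟧-periodic (∏^ ps)) c ⟩
      residues (pp p) a t c * residues (∏^ ps) a t c
        ≡⟨ cong (residues (pp p) a t c *_) (residues-factorise a t c unique primes) ⟩
      residues (pp p) a t c * ∏L ps (λ p → residues (pp p) a t c) ∎
      where
      p⊥ps = coprime-∏^ p-prime primes p∉ps
      instance
        _ = ∏^≢0 primes
        _ = ℕ.m^n≢0 p (r p) {{prime⇒nonZero p-prime}}

  ∏-∏L-comm : ∀ ps (f : Fin k → ℕ → ℤ) → ∏ (λ i → ∏L ps (f i)) ≡ ∏L ps (λ p → ∏ (λ i → f i p))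
  ∏-∏L-comm {k} []       f = ∏-1 k
    where
    ∏-1 : ∀ k → ∏ {k} (λ _ → 1ℤ) ≡ 1ℤ
    ∏-1 ℕ.zero    = refl
    ∏-1 (ℕ.suc k) = trans (*-identityˡ _) (∏-1 k)
  ∏-∏L-comm {k} (p ∷ ps) f = trans (∏-distrib-* (λ i → f i p) (λ i → ∏L ps (f i)))
    (cong (∏ (λ i → f i p) *_) (∏-∏L-comm ps f))

  multiplicity : List ℕ → ℕ → ℕ
  multiplicity fs p = length (filter (p ℕ.≟_) fs)

  multiplicity-≡ : ∀ p fs → multiplicity (p ∷ fs) p ≡ ℕ.suc (multiplicity fs p)
  multiplicity-≡ p fs = cong length (filter-accept (p ℕ.≟_) refl)

  multiplicity-≢ : ∀ {p f} fs → p ≢ f → multiplicity (f ∷ fs) p ≡ multiplicity fs p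
  multiplicity-≢ {p} fs p≢f = cong length (filter-reject (p ℕ.≟_) p≢f)

  ∏^-∷-∉ : ∀ {f ps} fs → All (f ≢_) ps → ∏^ (multiplicity (f ∷ fs)) ps ≡ ∏^ (multiplicity fs) ps
  ∏^-∷-∉ fs []                     = refl
  ∏^-∷-∉ fs (_∷_ {p} f≢p f∉ps) = cong₂ (λ j z → p ℕ.^ j ℕ.* z) (multiplicity-≢ fs (f≢p ∘ sym)) (∏^-∷-∉ fs f∉ps)

  -- A new factor f raises one exponent by one, and since the entries of `ps` are distinct it does
  -- so at one place only.
  ∏^-∷-∈ : ∀ {f ps} fs → Unique ps → f ∈ ps → ∏^ (multiplicity (f ∷ fs)) ps ≡ f ℕ.* ∏^ (multiplicity fs) ps
  ∏^-∷-∈ {f} {f ∷ ps} fs (f∉ps ∷ unique) (here refl) = trans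
    (cong₂ (λ j z → f ℕ.^ j ℕ.* z) (multiplicity-≡ f fs) (∏^-∷-∉ fs f∉ps))
    (ℕ.*-assoc f (f ℕ.^ multiplicity fs f) (∏^ (multiplicity fs) ps))
  ∏^-∷-∈ {f} {p ∷ ps} fs (p∉ps ∷ unique) (there f∈ps) = begin
    p ℕ.^ multiplicity (f ∷ fs) p ℕ.* ∏^ (multiplicity (f ∷ fs)) ps
      ≡⟨ cong₂ (λ j z → p ℕ.^ j ℕ.* z) (multiplicity-≢ fs (All.lookup p∉ps f∈ps)) (∏^-∷-∈ fs unique f∈ps) ⟩
    p ℕ.^ multiplicity fs p ℕ.* (f ℕ.* ∏^ (multiplicity fs) ps)
      ≡⟨ ℕ.*-assoc (p ℕ.^ multiplicity fs p) f (∏^ (multiplicity fs) ps) ⟨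
    p ℕ.^ multiplicity fs p ℕ.* f ℕ.* ∏^ (multiplicity fs) ps
      ≡⟨ cong (ℕ._* ∏^ (multiplicity fs) ps) (ℕ.*-comm (p ℕ.^ multiplicity fs p) f) ⟩
    f ℕ.* p ℕ.^ multiplicity fs p ℕ.* ∏^ (multiplicity fs) ps
      ≡⟨ ℕ.*-assoc f (p ℕ.^ multiplicity fs p) (∏^ (multiplicity fs) ps) ⟩
    f ℕ.* (p ℕ.^ multiplicity fs p ℕ.* ∏^ (multiplicity fs) ps) ∎

  ∏^-multiplicity : ∀ {ps fs} → Unique ps → All (_∈ ps) fs → ∏^ (multiplicity fs) ps ≡ product fs
  ∏^-multiplicity {ps} unique [] = helper ps
    where
    helper : ∀ ps → ∏^ (multiplicity []) ps ≡ 1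
    helper []       = refl
    helper (p ∷ ps) = trans (ℕ.*-identityˡ _) (helper ps)
  ∏^-multiplicity unique (_∷_ {f} {fs} f∈ps fs⊆ps) = trans (∏^-∷-∈ fs unique f∈ps)
    (cong (f ℕ.*_) (∏^-multiplicity unique fs⊆ps))

  module _ (n : ℕ) .{{_ : NonZero n}} where
    primeDivisors-unique : Unique (primeDivisors n)
    primeDivisors-unique = filter⁺ (λ p → prime? p ×-dec p ℕ.∣? n) (upTo⁺ (ℕ.suc n))

    ∈-primeDivisors⁺ : ∀ {p} → Prime p → p ℕ.∣ n → p ∈ primeDivisors n
    ∈-primeDivisors⁺ p-prime p∣n =
      ∈-filter⁺ (λ p → prime? p ×-dec p ℕ.∣? n) (∈-upTo⁺ (ℕ.s≤s (ℕ.∣⇒≤ p∣n))) (p-prime , p∣n)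

    ∈-primeDivisors⁻ : ∀ {p} → p ∈ primeDivisors n → Prime p × p ℕ.∣ n
    ∈-primeDivisors⁻ p∈ = proj₂ (∈-filter⁻ (λ p → prime? p ×-dec p ℕ.∣? n) {xs = upTo (ℕ.suc n)} p∈)

    primeDivisors-prime : All Prime (primeDivisors n)
    primeDivisors-prime = All.tabulate (proj₁ ∘ ∈-primeDivisors⁻)

    open PrimeFactorisation (factorise n)

    -- `multiplicity factors` computes to the `r` of the theorem, so this writes n as the product of
    -- the p ^ r p.
    factorisation : ∏^ (multiplicity factors) (primeDivisors n) ≡ n
    factorisation = trans (∏^-multiplicity primeDivisors-unique (All.tabulate factor∈)) (sym isFactorisation)
      where
      factor∈ : ∀ {f} → f ∈ factors → f ∈ primeDivisors n
      factor∈ f∈ = ∈-primeDivisors⁺ (All.lookup factorsPrime f∈) (subst (_ ℕ.∣_) (sym isFactorisation) (∈⇒∣product f∈))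

-- From integer identities to rational factors

module Rationals where
  open PrimeFactorisations using (∏L)
  open import Data.Bool using (if_then_else_)
  open import Data.Integer as ℤ using (ℤ; +_; 1ℤ)
  import Data.Integer.Properties as ℤ
  open import Data.Integer.Tactic.RingSolver using (solve-∀)
  open import Data.List using (List; []; _∷_; filter)
  open import Data.List.Relation.Unary.All using (All; []; _∷_)
  open import Data.Nat as ℕ using (ℕ; NonZero)
  open import Data.Rational as ℚ using (ℚ; 1ℚ; toℚᵘ; _+_; _*_; _-_; -_)
  open import Data.Rational.Properties
  open import Data.Rational.Solver using (module +-*-Solver)
  open import Data.Rational.Unnormalised as ℚᵘ using (ℚᵘ; mkℚᵘ; _≃_; *≡*)
  import Data.Rational.Unnormalised.Properties as ℚᵘ
  open import Defs using (_÷_; ∏ℚ)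
  open import Relation.Binary.PropositionalEquality
  open import Relation.Nullary using (yes; no; does)
  open import Relation.Unary using (Pred; Decidable)

  -- `fromℕ j` is `ι (+ j)` by definition.
  ι : ℤ → ℚ
  ι i = i ℚ./ 1

  -- Rationals are stored in lowest terms, so identities are checked on unnormalised
  -- representatives, where no gcd has to be computed.
  toℚᵘ-/ : ∀ i d → toℚᵘ (i ℚ./ ℕ.suc d) ≃ mkℚᵘ i d
  toℚᵘ-/ i d = toℚᵘ-fromℚᵘ (mkℚᵘ i d)

  ι-* : ∀ i j → ι (i ℤ.* j) ≡ ι i * ι j
  ι-* i j = toℚᵘ-injective (begin
    toℚᵘ (ι (i ℤ.* j))            ≈⟨ toℚᵘ-/ (i ℤ.* j) 0 ⟩
    mkℚᵘ i 0 ℚᵘ.* mkℚᵘ j 0         ≈⟨ ℚᵘ.*-cong (toℚᵘ-/ i 0) (toℚᵘ-/ j 0) ⟨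
    toℚᵘ (ι i) ℚᵘ.* toℚᵘ (ι j)    ≈⟨ toℚᵘ-homo-* (ι i) (ι j) ⟨
    toℚᵘ (ι i * ι j)              ∎)
    where open import Relation.Binary.Reasoning.Setoid ℚᵘ.≃-setoid

  ι-+ : ∀ i j → ι (i ℤ.+ j) ≡ ι i + ι j
  ι-+ i j = toℚᵘ-injective (begin
    toℚᵘ (ι (i ℤ.+ j))            ≈⟨ toℚᵘ-/ (i ℤ.+ j) 0 ⟩
    mkℚᵘ (i ℤ.+ j) 0              ≈⟨ *≡* (shuffle i j) ⟩
    mkℚᵘ i 0 ℚᵘ.+ mkℚᵘ j 0         ≈⟨ ℚᵘ.+-cong (toℚᵘ-/ i 0) (toℚᵘ-/ j 0) ⟨
    toℚᵘ (ι i) ℚᵘ.+ toℚᵘ (ι j)    ≈⟨ toℚᵘ-homo-+ (ι i) (ι j) ⟨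
    toℚᵘ (ι i + ι j)              ∎)
    where
    open import Relation.Binary.Reasoning.Setoid ℚᵘ.≃-setoid
    shuffle : ∀ i j → (i ℤ.+ j) ℤ.* 1ℤ ≡ (i ℤ.* 1ℤ ℤ.+ j ℤ.* 1ℤ) ℤ.* 1ℤ
    shuffle = solve-∀

  ι-neg : ∀ i → ι (ℤ.- i) ≡ - ι i
  ι-neg i = toℚᵘ-injective (begin
    toℚᵘ (ι (ℤ.- i))     ≈⟨ toℚᵘ-/ (ℤ.- i) 0 ⟩
    ℚᵘ.- mkℚᵘ i 0         ≈⟨ ℚᵘ.-‿cong (toℚᵘ-/ i 0) ⟨
    ℚᵘ.- toℚᵘ (ι i)      ≈⟨ toℚᵘ-homo‿- (ι i) ⟨
    toℚᵘ (- ι i)         ∎)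
    where open import Relation.Binary.Reasoning.Setoid ℚᵘ.≃-setoid

  -- Everything used about `_÷_` is derived from this cancellation.
  ÷-cancel : ∀ i d .{{_ : NonZero d}} → (i ÷ d) * ι (+ d) ≡ ι i
  ÷-cancel i (ℕ.suc d) = toℚᵘ-injective (begin
    toℚᵘ ((i ÷ ℕ.suc d) * ι (+ ℕ.suc d))           ≈⟨ toℚᵘ-homo-* (i ÷ ℕ.suc d) (ι (+ ℕ.suc d)) ⟩
    toℚᵘ (i ÷ ℕ.suc d) ℚᵘ.* toℚᵘ (ι (+ ℕ.suc d))   ≈⟨ ℚᵘ.*-cong (toℚᵘ-/ i d) (toℚᵘ-/ (+ ℕ.suc d) 0) ⟩
    mkℚᵘ i d ℚᵘ.* mkℚᵘ (+ ℕ.suc d) 0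
      ≈⟨ *≡* (trans (ℤ.*-identityʳ _) (cong (λ e → i ℤ.* + e) (sym (ℕ.*-identityʳ (ℕ.suc d))))) ⟩
    mkℚᵘ i 0                                       ≈⟨ toℚᵘ-/ i 0 ⟨
    toℚᵘ (ι i)                                     ∎)
    where
    import Data.Nat.Properties as ℕ
    open import Relation.Binary.Reasoning.Setoid ℚᵘ.≃-setoid

  -- The hypothesis divided by A B. For A = p ^ (r + 1 - m), B a power of p - 1 and s the same power
  -- of -1, the right-hand factor computes to `factor`.
  divide : ∀ A B .{{_ : NonZero A}} .{{_ : NonZero B}} N Π s → + A ℤ.* + B ℤ.* N ≡ Π ℤ.* (+ B ℤ.- s) →
           ι N ≡ ι Π * ((1ℤ ÷ A) * (1ℚ - s ÷ B))
  divide A B N Π s eq = begin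
    ι N
      ≡⟨ trans (*-identityˡ (1ℚ * ι N)) (*-identityˡ (ι N)) ⟨
    1ℚ * (1ℚ * ι N)
      ≡⟨ cong₂ (λ u v → u * (v * ι N)) (÷-cancel 1ℤ A) (÷-cancel 1ℤ B) ⟨
    A⁻¹ * ι (+ A) * (B⁻¹ * ι (+ B) * ι N)
      ≡⟨ solve 5 (λ a a′ b b′ n → a′ :* a :* (b′ :* b :* n) := a′ :* b′ :* (a :* b :* n)) refl (ι (+ A)) A⁻¹ (ι (+ B)) B⁻¹ (ι N) ⟩
    A⁻¹ * B⁻¹ * (ι (+ A) * ι (+ B) * ι N)
      ≡⟨ cong (A⁻¹ * B⁻¹ *_) ι-eq ⟩
    A⁻¹ * B⁻¹ * (ι Π * (ι (+ B) - ι s))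
      -- Writing s as (s ÷ B) B makes B a common factor of the difference, to be cancelled against
      -- B⁻¹.
      ≡⟨ cong (λ z → A⁻¹ * B⁻¹ * (ι Π * (ι (+ B) - z))) (÷-cancel s B) ⟨
    A⁻¹ * B⁻¹ * (ι Π * (ι (+ B) - (s ÷ B) * ι (+ B)))
      ≡⟨ solve 5 (λ a′ b b′ x σ → a′ :* b′ :* (x :* (b :- σ :* b))
                           := x :* (a′ :* (b′ :* b :- (b′ :* b) :* σ))) refl A⁻¹ (ι (+ B)) B⁻¹ (ι Π) (s ÷ B) ⟩
    ι Π * (A⁻¹ * (B⁻¹ * ι (+ B) - B⁻¹ * ι (+ B) * (s ÷ B)))
      ≡⟨ cong (λ z → ι Π * (A⁻¹ * (z - z * (s ÷ B)))) (÷-cancel 1ℤ B) ⟩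
    ι Π * (A⁻¹ * (1ℚ - 1ℚ * (s ÷ B)))
      ≡⟨ cong (λ z → ι Π * (A⁻¹ * (1ℚ - z))) (*-identityˡ (s ÷ B)) ⟩
    ι Π * (A⁻¹ * (1ℚ - s ÷ B)) ∎
    where
    open ≡-Reasoning
    open +-*-Solver
    A⁻¹ B⁻¹ : ℚ
    A⁻¹ = 1ℤ ÷ A
    B⁻¹ = 1ℤ ÷ B
    ι-eq : ι (+ A) * ι (+ B) * ι N ≡ ι Π * (ι (+ B) - ι s)
    ι-eq = begin
      ι (+ A) * ι (+ B) * ι N          ≡⟨ cong (_* ι N) (ι-* (+ A) (+ B)) ⟨
      ι (+ A ℤ.* + B) * ι N            ≡⟨ ι-* (+ A ℤ.* + B) N ⟨
      ι (+ A ℤ.* + B ℤ.* N)            ≡⟨ cong ι eq ⟩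
      ι (Π ℤ.* (+ B ℤ.- s))            ≡⟨ ι-* Π (+ B ℤ.- s) ⟩
      ι Π * ι (+ B ℤ.- s)              ≡⟨ cong (ι Π *_) (trans (ι-+ (+ B) (ℤ.- s)) (cong (λ z → ι (+ B) + z) (ι-neg s))) ⟩
      ι Π * (ι (+ B) - ι s)            ∎

  -- The restricted products become products over all prime divisors, with factor 1 at the primes
  -- left out, and can then be compared with the count prime by prime.
  ∏ℚ-filter : ∀ {ℓ} {P : Pred ℕ ℓ} (P? : Decidable P) ps f →
              ∏ℚ (filter P? ps) f ≡ ∏ℚ ps (λ p → if does (P? p) then f p else 1ℚ)
  ∏ℚ-filter P? []       f = refl
  ∏ℚ-filter P? (p ∷ ps) f with P? p
  ... | yes _ = cong (f p *_) (∏ℚ-filter P? ps f)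
  ... | no  _ = trans (∏ℚ-filter P? ps f) (sym (*-identityˡ _))

  ∏ℚ-* : ∀ ps f g → ∏ℚ ps (λ p → f p * g p) ≡ ∏ℚ ps f * ∏ℚ ps g
  ∏ℚ-* []       f g = refl
  ∏ℚ-* (p ∷ ps) f g = trans (cong (f p * g p *_) (∏ℚ-* ps f g))
    (solve 4 (λ a b c d → a :* b :* (c :* d) := a :* c :* (b :* d)) refl (f p) (g p) (∏ℚ ps f) (∏ℚ ps g))
    where open +-*-Solver

  ∏ℚ-cong : ∀ {ps f g} → All (λ p → f p ≡ g p) ps → ∏ℚ ps f ≡ ∏ℚ ps g
  ∏ℚ-cong []         = refl
  ∏ℚ-cong (eq ∷ eqs) = cong₂ _*_ eq (∏ℚ-cong eqs)

  ι-∏L : ∀ ps f → ι (∏L ps f) ≡ ∏ℚ ps (λ p → ι (f p))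
  ι-∏L []       f = refl
  ι-∏L (p ∷ ps) f = trans (ι-* (f p) (∏L ps f)) (cong (ι (f p) *_) (ι-∏L ps f))

-- Obstructions, local factors and the global formula

module RestrictedCongruence where
  open ResidueSums
  open Weights
  open WeightedCounts
  open PrimePowers
  open Counting
  open PrimeFactorisations
  open Rationals
  open import Data.Bool using (if_then_else_)
  open import Data.Fin using (Fin; zero; suc; toℕ)
  open import Data.Integer as ℤ using (ℤ; +_; 0ℤ; 1ℤ; -1ℤ; ∣_∣; _+_; _*_; _-_; -_; _^_)
  open import Data.Integer.Divisibility.Signed
  open import Data.Integer.Properties
  open import Data.Integer.Tactic.RingSolver using (solve-∀)
  open import Data.List.Membership.Propositional.Properties using (∈-filter⁺; ∈-allFin; ∈-length; ∈-map⁺)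
  import Data.List.Relation.Unary.All as All
  open import Data.Nat as ℕ using (ℕ; NonZero)
  import Data.Nat.Divisibility as ℕ
  open import Data.Nat.GCD using (gcd[m,n]∣m)
  open import Data.Nat.ListAction.Properties using (∈⇒∣product)
  open import Data.Nat.Primality using (Prime; prime⇒nonZero; prime⇒nonTrivial)
  import Data.Nat.Properties as ℕ
  open import Data.Product using (∃-syntax; _×_; _,_; proj₁; proj₂)
  open import Data.Rational as ℚ using (ℚ; 1ℚ)
  import Data.Rational.Properties as ℚ
  open import Data.Sum using (inj₁; inj₂)
  open import Defs
  open import Function using (_∘_)
  open import Relation.Binary.PropositionalEquality
  open import Relation.Nullary using (¬_; Dec; yes; no; does; contradiction)
  open import Relation.Nullary.Decidable using (_×-dec_; decidable-stable)
  open import Relation.Unary using (Decidable)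
  open ≡-Reasoning

  pos-^ : ∀ m j → + (m ℕ.^ j) ≡ (+ m) ^ j
  pos-^ m ℕ.zero    = refl
  pos-^ m (ℕ.suc j) = trans (pos-* m (m ℕ.^ j)) (cong (+ m *_) (pos-^ m j))

  pos-∏ : ∀ {k} (f : Fin k → ℕ) → + ∏ℕ f ≡ ∏ (λ i → + f i)
  pos-∏ {ℕ.zero}  f = refl
  pos-∏ {ℕ.suc k} f = trans (pos-* (f zero) (∏ℕ (f ∘ suc))) (cong (+ f zero *_) (pos-∏ (f ∘ suc)))

  ∣-∑ℤ : ∀ {k d} {f : Fin k → ℤ} → (∀ i → d ∣ f i) → d ∣ ∑ℤ f
  ∣-∑ℤ {ℕ.zero}  d∣f = divides 0ℤ refl
  ∣-∑ℤ {ℕ.suc k} d∣f = ∣m∣n⇒∣m+n (d∣f zero) (∣-∑ℤ (d∣f ∘ suc))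

  if-yes : ∀ {ℓ ℓ′} {A : Set ℓ} {P : Set ℓ′} (P? : Dec P) {x y : A} → P → (if does P? then x else y) ≡ x
  if-yes (yes _)  _ = refl
  if-yes (no ¬p) p = contradiction p ¬p

  if-no : ∀ {ℓ ℓ′} {A : Set ℓ} {P : Set ℓ′} (P? : Dec P) {x y : A} → ¬ P → (if does P? then x else y) ≡ y
  if-no (yes p) ¬p = contradiction p ¬p
  if-no (no _)  _  = refl

  cardinality≥1 : ∀ {k ℓ} {P : Fin k → Set ℓ} (P? : Decidable P) {i} → P i → 1 ℕ.≤ cardinality P?
  cardinality≥1 P? {i} Pi = ∈-length (∈-filter⁺ P? (∈-allFin i) Pi)

  module _ {k : ℕ} (n : ℕ) .{{_ : NonZero n}} (a : Fin k → ℤ) (b : ℤ) (t : Fin k → ℕ)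
           (a≢0 : ∃[ i ] a i ≢ 0ℤ) (t>0 : ∀ i → NonZero (t i)) (t∣n : ∀ i → t i ℕ.∣ n) where
    open Congruence n a b t

    p^r∣n : ∀ {p} → Prime p → p ℕ.∣ n → p ℕ.^ r p ℕ.∣ n
    p^r∣n {p} p-prime p∣n = subst (p ℕ.^ r p ℕ.∣_) (factorisation n)
      (∈⇒∣product (∈-map⁺ (λ p → p ℕ.^ r p) (∈-primeDivisors⁺ n p-prime p∣n)))

    p^j∣at : ∀ {p} → Prime p → ∀ j → j ℕ.< m p → ∀ i → + (p ℕ.^ j) ∣ a i * + t i
    -- The minimality of m only concerns exponents from 1 on, so j = 0 is treated apart.
    p^j∣at p-prime ℕ.zero    _     i = ∣ᵤ⇒∣ (ℕ.1∣ ∣ a i * + t i ∣)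
    p^j∣at {p} p-prime (ℕ.suc j) 1+j<m i = ∣ᵤ⇒∣ (decidable-stable ((p ℕ.^ ℕ.suc j) ∣ℤ? (a i * + t i))
      (λ ∤ → proj₂ (proj₂ (m-isLeast n a b t a≢0 t>0 p p-prime)) (ℕ.suc j) (ℕ.s≤s ℕ.z≤n) 1+j<m (i , ∤)))

    -- tᵢ = gcd (xᵢ , n) divides xᵢ, so d divides every aᵢ xᵢ and hence b. The two kinds of
    -- obstruction contradict this for d = p ^ (m - 1) and d = p ^ r.
    solution⇒∣b : ∀ {d} → d ℕ.∣ n → (∀ i → + d ∣ a i * + t i) → ∀ x → IsSolution x → + d ∣ b
    solution⇒∣b {d} d∣n d∣at x (n∣Σ-b , gcds) = ∣-resp (cancel (∑ℤ (λ i → a i * + toℕ (x i))) b)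
      (∣m∣n⇒∣m-n (∣-∑ℤ d∣ax) (∣-trans (∣ᵤ⇒∣ {+ d} {+ n} d∣n) (∣ᵤ⇒∣ n∣Σ-b)))
      where
      cancel : ∀ x b → x - (x - b) ≡ b
      cancel = solve-∀
      d∣ax : ∀ i → + d ∣ a i * + toℕ (x i)
      d∣ax i = ∣-trans (d∣at i) (*-monoʳ-∣ (a i) (∣ᵤ⇒∣ (subst (ℕ._∣ toℕ (x i)) (gcds i) (gcd[m,n]∣m (toℕ (x i)) n))))

    obstruction⇒noSolution : (∃[ p ] (Prime p × p ℕ.∣ n × Obstruction p)) → ¬ (∃[ x ] IsSolution x)
    obstruction⇒noSolution (p , p-prime , p∣n , inj₁ (m≤r , ∤b)) (x , x-sol) = ∤b (∣⇒∣ᵤ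
      (solution⇒∣b (ℕ.∣-trans (^-monoʳ-∣ p (ℕ.<⇒≤ m≤r)) (p^r∣n p-prime p∣n))
                   (p^j∣at p-prime (m p ℕ.∸ 1) ℕ.≤-refl) x x-sol))
    obstruction⇒noSolution (p , p-prime , p∣n , inj₂ (r+1≤m , ∤b)) (x , x-sol) = ∤b (∣⇒∣ᵤ
      (solution⇒∣b (p^r∣n p-prime p∣n)
                   (p^j∣at p-prime (r p) (subst (ℕ._≤ m p) (ℕ.+-comm (r p) 1) r+1≤m)) x x-sol))

    factor-∣ factor-∥ : ℕ → ℚ
    factor-∣ p = if does (m p ℕ.≤? r p ×-dec ((p ℕ.^ m p) ∣ℤ? b)) then factor p (e p ℕ.∸ 1) else 1ℚ
    factor-∥ p = if does (m p ℕ.≤? r p ×-dec ∥? p (m p ℕ.∸ 1) b) then factor p (e p) else 1ℚ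

    localProduct : ℕ → ℤ
    localProduct p = ∏ (λ i → Φ (p ℕ.^ r p) (t i))

    module _ {p} (p-prime : Prime p) (p∣n : p ℕ.∣ n) (¬obstruction : ¬ Obstruction p) where
      private
        instance
          p≢0 : NonZero p
          p≢0 = prime⇒nonZero p-prime
          p-1≢0 : NonZero (p ℕ.∸ 1)
          p-1≢0 = ℕ.>-nonZero (ℕ.∸-monoˡ-≤ {2} {p} 1 (ℕ.nonTrivial⇒n>1 p {{prime⇒nonTrivial p-prime}}))

        Π N : ℤ
        Π = localProduct p
        N = residues (p ℕ.^ r p) a t (- b)

        E≡ : + p - 1ℤ ≡ + (p ℕ.∸ 1)
        E≡ = trans (m-n≡m⊖n p 1) (⊖-≥ (ℕ.>-nonZero⁻¹ p))

        E^≡ : ∀ j → + ((p ℕ.∸ 1) ℕ.^ j) ≡ (+ p - 1ℤ) ^ j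
        E^≡ j = trans (pos-^ (p ℕ.∸ 1) j) (cong (_^ j) (sym E≡))

        A : ℕ
        A = p ℕ.^ (r p ℕ.+ 1 ℕ.∸ m p)

        -- `m p` is a successor by definition, so suc (r p) ∸ m p computes to r p ∸ (m p ∸ 1), and
        -- only r + 1 = 1 + r needs a proof.
        A≡ : A ≡ p ℕ.^ (r p ℕ.∸ (m p ℕ.∸ 1))
        A≡ = cong (λ j → p ℕ.^ (j ℕ.∸ m p)) (ℕ.+-comm (r p) 1)

        instance
          A≢0 : NonZero A
          A≢0 = ℕ.m^n≢0 p (r p ℕ.+ 1 ℕ.∸ m p)

        i₀ : Fin k
        i₀ = proj₁ (proj₁ (proj₂ (m-isLeast n a b t a≢0 t>0 p p-prime)))
        p^m∤at : ¬ + (p ℕ.^ m p) ∣ a i₀ * + t i₀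
        p^m∤at = proj₂ (proj₁ (proj₂ (m-isLeast n a b t a≢0 t>0 p p-prime))) ∘ ∣⇒∣ᵤ

        ∣-b : ∀ d → d ℕ.∣ ∣ b ∣ → + d ∣ - b
        ∣-b d d∣b = ∣m⇒∣-m {+ d} {b} (∣ᵤ⇒∣ d∣b)

        ∣-b⇒∣b : ∀ d → + d ∣ - b → d ℕ.∣ ∣ b ∣
        ∣-b⇒∣b d d∣-b = subst (d ℕ.∣_) (∣-i∣≡∣i∣ b) (∣⇒∣ᵤ d∣-b)

        count-eq : (m≤r : m p ℕ.≤ r p) → p ℕ.^ (m p ℕ.∸ 1) ℕ.∣ ∣ b ∣ →
                   + A * (+ p - 1ℤ) ^ e p * N
                   ≡ Π * ((+ p - 1ℤ) ^ e p - -1ℤ ^ e p + + p * -1ℤ ^ e p * ⟦ + (p ℕ.^ m p) ∣? - b ⟧)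
        count-eq m≤r p^M∣b = trans (cong (λ A → + A * (+ p - 1ℤ) ^ e p * N) A≡)
          (count-prime-power p-prime (r p) (m p ℕ.∸ 1) m≤r a t (p^j∣at p-prime (m p ℕ.∸ 1) ℕ.≤-refl)
             i₀ p^m∤at (- b) (∣-b _ p^M∣b))

        -- The indicator is 1, and E ^ e - (-1) ^ e + p (-1) ^ e = E (E ^ (e - 1) - (-1) ^ (e - 1))
        -- for E = p - 1, so one E cancels. Here e ≥ 1, because the index `i₀` witnessing the choice
        -- of m is counted by e.
        local-∣ : m p ℕ.≤ r p → p ℕ.^ m p ℕ.∣ ∣ b ∣ → ι N ≡ ι Π ℚ.* factor p (e p ℕ.∸ 1)
        local-∣ m≤r p^m∣b = divide A ((p ℕ.∸ 1) ℕ.^ e′) {{A≢0}} {{ℕ.m^n≢0 (p ℕ.∸ 1) e′}} N Π (-1ℤ ^ e′)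
          (trans (cong (λ z → + A * z * N) (E^≡ e′))
            (trans cancelled (cong (λ z → Π * (z - -1ℤ ^ e′)) (sym (E^≡ e′)))))
          where
          e′ = e p ℕ.∸ 1
          e≡ : e p ≡ ℕ.suc e′
          e≡ = sym (ℕ.m+[n∸m]≡n (cardinality≥1 _ {i₀} (p^m∤at ∘ ∣ᵤ⇒∣)))
          collect : ∀ p A X N → (p - 1ℤ) * (A * X * N) ≡ A * ((p - 1ℤ) * X) * N
          collect = solve-∀
          expand : ∀ p Π X s → Π * ((p - 1ℤ) * X - -1ℤ * s + p * (-1ℤ * s) * 1ℤ) ≡ (p - 1ℤ) * (Π * (X - s))
          expand = solve-∀
          instance
            E≢0 : ℤ.NonZero (+ p - 1ℤ)
            E≢0 = subst ℤ.NonZero (sym E≡) p-1≢0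
          cancelled : + A * (+ p - 1ℤ) ^ e′ * N ≡ Π * ((+ p - 1ℤ) ^ e′ - -1ℤ ^ e′)
          cancelled = *-cancelˡ-≡ (+ p - 1ℤ) _ _ (begin
            (+ p - 1ℤ) * (+ A * (+ p - 1ℤ) ^ e′ * N)
              ≡⟨ collect (+ p) (+ A) ((+ p - 1ℤ) ^ e′) N ⟩
            + A * (+ p - 1ℤ) ^ ℕ.suc e′ * N
              ≡⟨ subst (λ e → + A * (+ p - 1ℤ) ^ e * N
                            ≡ Π * ((+ p - 1ℤ) ^ e - -1ℤ ^ e + + p * -1ℤ ^ e * ⟦ + (p ℕ.^ m p) ∣? - b ⟧)) e≡
                   (count-eq m≤r (ℕ.∣-trans (ℕ.n∣m*n p) p^m∣b)) ⟩
            Π * ((+ p - 1ℤ) ^ ℕ.suc e′ - -1ℤ ^ ℕ.suc e′ + + p * -1ℤ ^ ℕ.suc e′ * ⟦ + (p ℕ.^ m p) ∣? - b ⟧)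
              ≡⟨ cong (λ z → Π * ((+ p - 1ℤ) ^ ℕ.suc e′ - -1ℤ ^ ℕ.suc e′ + + p * -1ℤ ^ ℕ.suc e′ * z))
                   (⟦⟧-true (+ (p ℕ.^ m p) ∣? - b) (∣-b _ p^m∣b)) ⟩
            Π * ((+ p - 1ℤ) ^ ℕ.suc e′ - -1ℤ ^ ℕ.suc e′ + + p * -1ℤ ^ ℕ.suc e′ * 1ℤ)
              ≡⟨ expand (+ p) Π ((+ p - 1ℤ) ^ e′) (-1ℤ ^ e′) ⟩
            (+ p - 1ℤ) * (Π * ((+ p - 1ℤ) ^ e′ - -1ℤ ^ e′)) ∎)

        -- The indicator is 0, so the term with p drops out and the exponent stays e.
        local-∥ : m p ℕ.≤ r p → p ^ m p ℕ.∸ 1 ∥ b → ι N ≡ ι Π ℚ.* factor p (e p)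
        local-∥ m≤r (p^M∣b , p^m∤b) = divide A ((p ℕ.∸ 1) ℕ.^ e p) {{A≢0}} {{ℕ.m^n≢0 (p ℕ.∸ 1) (e p)}} N Π (-1ℤ ^ e p) (begin
          + A * + ((p ℕ.∸ 1) ℕ.^ e p) * N
            ≡⟨ cong (λ z → + A * z * N) (E^≡ (e p)) ⟩
          + A * (+ p - 1ℤ) ^ e p * N
            ≡⟨ count-eq m≤r p^M∣b ⟩
          Π * ((+ p - 1ℤ) ^ e p - -1ℤ ^ e p + + p * -1ℤ ^ e p * ⟦ + (p ℕ.^ m p) ∣? - b ⟧)
            ≡⟨ cong₂ (λ x z → Π * (x - -1ℤ ^ e p + + p * -1ℤ ^ e p * z)) (sym (E^≡ (e p)))
                 (⟦⟧-false (+ (p ℕ.^ m p) ∣? - b) (p^m∤b ∘ ∣-b⇒∣b _)) ⟩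
          Π * (+ ((p ℕ.∸ 1) ℕ.^ e p) - -1ℤ ^ e p + + p * -1ℤ ^ e p * 0ℤ)
            ≡⟨ drop Π (+ ((p ℕ.∸ 1) ℕ.^ e p)) (-1ℤ ^ e p) (+ p * -1ℤ ^ e p) ⟩
          Π * (+ ((p ℕ.∸ 1) ℕ.^ e p) - -1ℤ ^ e p) ∎)
          where
          drop : ∀ Π B s y → Π * (B - s + y * 0ℤ) ≡ Π * (B - s)
          drop = solve-∀

        -- Such a prime belongs to neither product. That there is no obstruction means p ^ r ∣ b, so
        -- every admissible tuple is a solution modulo p ^ r.
        local-> : r p ℕ.< m p → N ≡ Π
        local-> r<m = trans (count-divisible p-prime (r p) a t (p^j∣at p-prime (r p) r<m) (- b))
          (trans (cong (Π *_) (⟦⟧-true (+ (p ℕ.^ r p) ∣? - b) (∣-b _ p^r∣b))) (*-identityʳ Π))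
          where
          p^r∣b : p ℕ.^ r p ℕ.∣ ∣ b ∣
          p^r∣b = decidable-stable ((p ℕ.^ r p) ∣ℤ? b)
            (λ ∤b → ¬obstruction (inj₂ (subst (ℕ._≤ m p) (ℕ.+-comm 1 (r p)) r<m , ∤b)))

        p^m∣? = m p ℕ.≤? r p ×-dec ((p ℕ.^ m p) ∣ℤ? b)
        p^M∥? = m p ℕ.≤? r p ×-dec ∥? p (m p ℕ.∸ 1) b

        conclude : ∀ {x y} → factor-∣ p ≡ x → factor-∥ p ≡ y → ι N ≡ ι Π ℚ.* (x ℚ.* y) →
                   ι N ≡ ι Π ℚ.* (factor-∣ p ℚ.* factor-∥ p)
        conclude refl refl eq = eq

        helper : Dec (m p ℕ.≤ r p) → Dec (p ℕ.^ m p ℕ.∣ ∣ b ∣) → ι N ≡ ι Π ℚ.* (factor-∣ p ℚ.* factor-∥ p)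
        helper (no m≰r) _ = conclude (if-no p^m∣? (m≰r ∘ proj₁)) (if-no p^M∥? (m≰r ∘ proj₁))
          (trans (cong ι (local-> (ℕ.≰⇒> m≰r))) (sym (ℚ.*-identityʳ (ι Π))))
        helper (yes m≤r) (yes p^m∣b) = conclude (if-yes p^m∣? (m≤r , p^m∣b)) (if-no p^M∥? (λ (_ , _ , ∤b) → ∤b p^m∣b))
          (trans (local-∣ m≤r p^m∣b) (cong (ι Π ℚ.*_) (sym (ℚ.*-identityʳ (factor p (e p ℕ.∸ 1))))))
        -- The absence of an obstruction supplies p ^ (m - 1) ∣ b, so that failing p ^ m ∣ b puts p
        -- in the second product.
        helper (yes m≤r) (no p^m∤b) = conclude (if-no p^m∣? (p^m∤b ∘ proj₂)) (if-yes p^M∥? (m≤r , p^M∥b))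
          (trans (local-∥ m≤r p^M∥b) (cong (ι Π ℚ.*_) (sym (ℚ.*-identityˡ (factor p (e p))))))
          where
          p^M∥b : p ^ m p ℕ.∸ 1 ∥ b
          p^M∥b = decidable-stable ((p ℕ.^ (m p ℕ.∸ 1)) ∣ℤ? b) (λ ∤b → ¬obstruction (inj₁ (m≤r , ∤b))) , p^m∤b

      residues-local : ι N ≡ ι Π ℚ.* (factor-∣ p ℚ.* factor-∥ p)
      residues-local = helper (m p ℕ.≤? r p) ((p ℕ.^ m p) ∣ℤ? b)

    -- The products over primes and coordinates are exchanged; for fixed i, multiplicativity of Φ
    -- reassembles Φ n (t i) from the prime powers.
    ∏-localProduct : ∏L (primeDivisors n) localProduct ≡ + ∏ℕ (λ i → φ ((n ℕ./ t i) {{t>0 i}}))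
    ∏-localProduct = begin
      ∏L (primeDivisors n) localProduct
        ≡⟨ ∏-∏L-comm (primeDivisors n) (λ i p → Φ (p ℕ.^ r p) (t i)) ⟨
      ∏ (λ i → ∏L (primeDivisors n) (λ p → Φ (p ℕ.^ r p) (t i)))
        ≡⟨ ∏-cong (λ i → Φ-factorise r (t i) (primeDivisors-unique n) (primeDivisors-prime n)) ⟨
      ∏ (λ i → Φ (∏^ r (primeDivisors n)) (t i))
        ≡⟨ ∏-cong (λ i → trans (cong (λ n → Φ n (t i)) (factorisation n)) (Φ≡φ n (t i) {{t>0 = t>0 i}} (t∣n i))) ⟩
      ∏ (λ i → + φ ((n ℕ./ t i) {{t>0 i}}))
        ≡⟨ pos-∏ (λ i → φ ((n ℕ./ t i) {{t>0 i}})) ⟨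
      + ∏ℕ (λ i → φ ((n ℕ./ t i) {{t>0 i}})) ∎

    numberOfSolutions-formula : ¬ (∃[ p ] (Prime p × p ℕ.∣ n × Obstruction p)) →
      fromℕ numberOfSolutions ≡
        fromℕ (∏ℕ (λ i → φ ((n ℕ./ t i) {{t>0 i}})))
        ℚ.* ∏ℚ primes-∣ (λ p → factor p (e p ℕ.∸ 1))
        ℚ.* ∏ℚ primes-∥ (λ p → factor p (e p))
    numberOfSolutions-formula ¬obstruction = begin
      ι (+ numberOfSolutions)
        ≡⟨ cong ι (numberOfSolutions≡residues n a b t t∣n) ⟩
      ι (residues n a t (- b))
        ≡⟨ cong (λ n → ι (residues n a t (- b))) (factorisation n) ⟨
      ι (residues (∏^ r ps) a t (- b))
        ≡⟨ cong ι (residues-factorise r a t (- b) (primeDivisors-unique n) (primeDivisors-prime n)) ⟩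
      ι (∏L ps (λ p → residues (p ℕ.^ r p) a t (- b)))
        ≡⟨ ι-∏L ps (λ p → residues (p ℕ.^ r p) a t (- b)) ⟩
      ∏ℚ ps (λ p → ι (residues (p ℕ.^ r p) a t (- b)))
        ≡⟨ ∏ℚ-cong (All.tabulate (λ {p} p∈ps →
             let p-prime , p∣n = ∈-primeDivisors⁻ n p∈ps
             in residues-local p-prime p∣n (λ obstruction → ¬obstruction (p , p-prime , p∣n , obstruction)))) ⟩
      ∏ℚ ps (λ p → ι (localProduct p) ℚ.* (factor-∣ p ℚ.* factor-∥ p))
        ≡⟨ trans (∏ℚ-* ps (ι ∘ localProduct) (λ p → factor-∣ p ℚ.* factor-∥ p))
             (cong (∏ℚ ps (ι ∘ localProduct) ℚ.*_) (∏ℚ-* ps factor-∣ factor-∥)) ⟩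
      ∏ℚ ps (ι ∘ localProduct) ℚ.* (∏ℚ ps factor-∣ ℚ.* ∏ℚ ps factor-∥)
        ≡⟨ ℚ.*-assoc (∏ℚ ps (ι ∘ localProduct)) (∏ℚ ps factor-∣) (∏ℚ ps factor-∥) ⟨
      ∏ℚ ps (ι ∘ localProduct) ℚ.* ∏ℚ ps factor-∣ ℚ.* ∏ℚ ps factor-∥
        ≡⟨ cong₂ ℚ._*_ (cong₂ ℚ._*_
             (trans (sym (ι-∏L ps localProduct)) (cong ι ∏-localProduct))
             (sym (∏ℚ-filter (λ p → m p ℕ.≤? r p ×-dec ((p ℕ.^ m p) ∣ℤ? b)) ps (λ p → factor p (e p ℕ.∸ 1)))))
             (sym (∏ℚ-filter (λ p → m p ℕ.≤? r p ×-dec ∥? p (m p ℕ.∸ 1) b) ps (λ p → factor p (e p)))) ⟩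
      fromℕ (∏ℕ (λ i → φ ((n ℕ./ t i) {{t>0 i}})))
        ℚ.* ∏ℚ primes-∣ (λ p → factor p (e p ℕ.∸ 1))
        ℚ.* ∏ℚ primes-∥ (λ p → factor p (e p)) ∎
      where
      ps = primeDivisors n

open import Defs
open import Data.Fin using (Fin)
open import Data.Integer using (ℤ; 0ℤ)
open import Data.Nat using (ℕ; NonZero; _∸_; _/_)
open import Data.Nat.Divisibility using (_∣_)
open import Data.Nat.Primality using (Prime)
open import Data.Product using (∃; ∃-syntax; _×_; _,_)
open import Data.Rational using (_*_)
open import Relation.Binary.PropositionalEquality using (_≡_; _≢_)
open import Relation.Nullary using (¬_)

open RestrictedCongruence

theorem3p9 :
    (k n : ℕ) → .{{_ : NonZero k}} → .{{_ : NonZero n}} →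
    (a : Fin k → ℤ) (b : ℤ) (t : Fin k → ℕ) →
    (∃[ i ] a i ≢ 0ℤ) →
    (t>0 : ∀ i → NonZero (t i)) →
    (∀ i → t i ∣ n) →
    let open Congruence n a b t in
    ((∃[ p ] (Prime p × p ∣ n × Obstruction p)) → ¬ (∃[ x ] IsSolution x))
    ×
    (¬ (∃[ p ] (Prime p × p ∣ n × Obstruction p)) →
      fromℕ numberOfSolutions ≡
        fromℕ (∏ℕ (λ i → φ ((n / t i) {{t>0 i}})))
        * ∏ℚ primes-∣ (λ p → factor p (e p ∸ 1))
        * ∏ℚ primes-∥ (λ p → factor p (e p)))
theorem3p9 k n a b t a≢0 t>0 t∣n =
  obstruction⇒noSolution n a b t a≢0 t>0 t∣n , numberOfSolutions-formula n a b t a≢0 t>0 t∣n
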